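{- Let $n\ge 1$. Every $n$-periodic infinite frieze $\mathcal{F}_\Pi$ associated to a triangulation $\Pi$ of the once-punctured disc $S_n^1$ is $n$-arithmetic.
   Context: Infinite friezes: an infinite frieze is an array $(m_{ij})_{i,j\in\mathbb{Z},\,j-i\ge -2}$ of integers with $m_{i,i-2}=0$ and $m_{i,i-1}=1$ for all $i\in\mathbb{Z}$, $m_{ij}>0$ for all $j\ge i$, and $m_{ij}m_{i+1,j+1}-m_{i+1,j}m_{i,j+1}=1$ for all $j-i\ge -1$. It is $n$-periodic if $m_{ij}=m_{i+n,j+n}$ for all $i\le j$. Its quiddity sequence is then the $n$-tuple $(m_{11},\dots,m_{nn})$ (up to cyclic equivalence); it determines the frieze. Arithmetic friezes: for an infinite frieze $\mathcal{F}=(m_{ij})_{j-i\ge-2}$ and an integer $r\ge 1$, put $d_{ik}:=m_{i,(i+k-3)+r}-m_{i,i+k-3}$ for all $i\in\mathbb{Z}$ and $k\in\{1,\dots,r\}$. $\mathcal{F}$ is $r$-arithmetic if $m_{i,(i+k-3)+(l+1)r}-m_{i,(i+k-3)+lr}=d_{ik}$ for all $l\ge 0$, all $i\in\mathbb{Z}$ and all $k\in\{1,\dots,r\}$. Triangulations: for $n\ge 1$, $S_n^1$ is a closed disc with $n$ marked points on the boundary, labeled $1,2,\dots,n$ in clockwise order, and one marked point in the interior, the puncture, labeled $0$. An arc in $S_n^1$ is (the isotopy class of) a non-self-intersecting curve connecting two marked points (possibly equal, in which case it is a loop) which is non-boundary, i.e. not isotopic to a boundary segment between neighboring marked points. The arcs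 are: the bridging arcs $0j$ connecting the puncture with the boundary marked point $j$; and the peripheral arcs $ij$ ($i=j$ allowed), where $ij$ is the arc isotopic to the boundary segment going clockwise from $i$ to $j$ when all marked points on the boundary other than $i$ and $j$ are ignored. Two arcs are non-crossing if they do not meet in the interior of $S_n^1$ (away from the puncture). A triangulation $\Pi$ of $S_n^1$ is a maximal collection of pairwise non-crossing arcs. The quiddity sequence of $\Pi$ is $q_\Pi=(a_1,\dots,a_n)$, where $a_i$ is the number of connected components of $(S_n^1\setminus\Pi)\cap U$ for $U$ a small neighborhood of the boundary marked point $i$. The infinite frieze $\mathcal{F}_\Pi$ associated to $\Pi$ is the $n$-periodic infinite frieze whose quiddity sequence is $q_\Pi$ (it exists). -}

module Defs where

open import Data.Nat as ℕ using (ℕ; suc)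
open import Data.Integer using (ℤ; +_; -_; _+_; _-_; _*_; _≤_; _<_)
open import Data.Integer.Divisibility using (_∣_)
open import Data.Fin using (Fin; toℕ)
open import Data.Fin.Properties using (_≟_)
open import Data.Bool using (if_then_else_)
open import Data.Empty using (⊥)
open import Data.List using (List; map; sum)
open import Data.List.Relation.Binary.Subset.Propositional using (_⊆_)
open import Data.List.Relation.Unary.AllPairs using (AllPairs)
open import Data.List.Relation.Unary.Unique.Propositional using (Unique)
open import Data.Product using (_×_; ∃-syntax)
open import Data.Sum using (_⊎_)
open import Relation.Binary.PropositionalEquality using (_≡_)
open import Relation.Nullary using (¬_; does)

-- An array (m i j) with j - i ≥ -2 is a total function on ℤ × ℤ; the entries
-- with j - i < -2 are never constrained and never used.
Array : Set
Array = ℤ → ℤ → ℤ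

record IsInfiniteFrieze (m : Array) : Set where
  field
    zeros    : ∀ i → m i (i - + 2) ≡ + 0
    ones     : ∀ i → m i (i - + 1) ≡ + 1
    positive : ∀ i j → i ≤ j → + 0 < m i j
    diamond  : ∀ i j → - (+ 1) ≤ j - i →
               m i j * m (i + + 1) (j + + 1) - m (i + + 1) j * m i (j + + 1) ≡ + 1

IsPeriodic : ℕ → Array → Set
IsPeriodic n m = ∀ i j → i ≤ j → m i j ≡ m (i + + n) (j + + n)

difference : ℕ → Array → ℤ → ℕ → ℤ
difference r m i k = m i ((i + + k - + 3) + + r) - m i (i + + k - + 3)

IsArithmetic : ℕ → Array → Set
IsArithmetic r m =
  ∀ (l : ℕ) (i : ℤ) (k : ℕ) → 1 ℕ.≤ k → k ℕ.≤ r →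
    m i ((i + + k - + 3) + + (suc l ℕ.* r)) - m i ((i + + k - + 3) + + (l ℕ.* r))
      ≡ difference r m i k

-- The boundary marked points 1, …, n, in clockwise order.
Point : ℕ → Set
Point n = Fin n

label : ∀ {n} → Point n → ℤ
label p = + suc (toℕ p)

-- The universal cover of the disc minus its puncture is a half-plane whose
-- boundary marked points are the integers, numbered clockwise; an integer lies
-- over the marked point to which it is congruent modulo n.
_Over_ : ∀ {n} → ℤ → Point n → Set
_Over_ {n} a p = + n ∣ a - label p

-- Going clockwise from i to j is a boundary segment between neighbours exactly
-- when j ≡ i + 1 (mod n).  For n = 1 this is the closed segment from 1 to 1.
IsBoundarySegment : ∀ {n} → Point n → Point n → Set
IsBoundarySegment i j = (label i + + 1) Over j

-- Isotopy classes of arcs: `bridging j` is the arc 0j, and `peripheral i j` is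
-- the arc that follows the boundary clockwise from i to j (once around the
-- puncture if i = j).
data Arc (n : ℕ) : Set where
  bridging   : Point n → Arc n
  peripheral : (i j : Point n) → .(¬ IsBoundarySegment i j) → Arc n

-- The lifts of the peripheral arc ij to the universal cover join a to b, where
-- a lies over i and b is the first integer after a that lies over j.
IsLift : ∀ {n} → Point n → Point n → ℤ → ℤ → Set
IsLift {n} i j a b = a Over i × b Over j × a < b × b ≤ a + + n

-- Isotopy classes of arcs cross when all their representatives meet in the
-- interior away from the puncture, i.e. when the endpoints of some of their
-- lifts interleave; the lifts of a bridging arc go from c over k to infinity.
BridgeCrosses : ∀ {n} → Point n → Point n → Point n → Set
BridgeCrosses k i j =
  ∃[ a ] ∃[ b ] ∃[ c ] IsLift i j a b × c Over k × a < c × c < b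

Crosses : ∀ {n} → Arc n → Arc n → Set
Crosses (bridging _)       (bridging _)       = ⊥
Crosses (bridging k)       (peripheral i j _) = BridgeCrosses k i j
Crosses (peripheral i j _) (bridging k)       = BridgeCrosses k i j
Crosses (peripheral i j _) (peripheral k l _) =
  ∃[ a ] ∃[ b ] ∃[ c ] ∃[ d ] IsLift i j a b × IsLift k l c d ×
    ((a < c × c < b × b < d) ⊎ (c < a × a < d × d < b))

PairwiseNonCrossing : ∀ {n} → List (Arc n) → Set
PairwiseNonCrossing = AllPairs (λ α β → ¬ Crosses α β)

-- There are finitely many arcs, so a collection of arcs is a duplicate-free list.
record IsTriangulation {n : ℕ} (Π : List (Arc n)) : Set where
  field
    unique      : Unique Π
    nonCrossing : PairwiseNonCrossing Π
    maximal     : ∀ (Π′ : List (Arc n)) → Unique Π′ → PairwiseNonCrossing Π′ →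
                  Π ⊆ Π′ → Π′ ⊆ Π

δ : ∀ {n} → Point n → Point n → ℕ
δ i j = if does (i ≟ j) then 1 else 0

-- The number of ends of an arc at i; a loop based at i has two of them.
ends : ∀ {n} → Point n → Arc n → ℕ
ends i (bridging j)       = δ i j
ends i (peripheral j k _) = δ i j ℕ.+ δ i k

-- A small neighbourhood of a boundary point is a half-disc, which e arc ends
-- cut into e + 1 components.
quiddity : ∀ {n} → List (Arc n) → Point n → ℕ
quiddity Π i = suc (sum (map (ends i) Π))

record IsFriezeOf {n : ℕ} (Π : List (Arc n)) (m : Array) : Set where
  field
    isInfiniteFrieze : IsInfiniteFrieze m
    isPeriodic       : IsPeriodic n m
    hasQuiddity      : ∀ i → m (label i) (label i) ≡ + quiddity Π i

{-# OPTIONS --safe #-}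

-- Let a frieze row f satisfy f (c - 1) + f (c + 1) = a c * f c.  In the universal cover of the
-- punctured disc the arcs cut the strip below each arc (x , y) into triangles x < c < y, and
-- counting the arcs at c gives f c = f x + f y in each of them.  A vertex c that carries a bridging
-- arc has one more arc end, so there the count gives f b + f d = 2 f c for the neighbouring bridging
-- vertices b and d: the row f is an arithmetic progression along the bridging vertices.  Hence the
-- second difference of f with step n, which solves the same recurrence, vanishes at two consecutive
-- bridging vertices; by the triangle relation it then vanishes at two adjacent positions, and so
-- everywhere.
module Submission where

open import Data.Empty using (⊥; ⊥-elim-irr)
open import Data.Fin using (toℕ; fromℕ<)
import Data.Fin.Properties as Finₚ
open import Data.Integer using (ℤ; +_; -[1+_]; -_; _+_; _-_; _*_; _≤_; _<_; ∣_∣)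
import Data.Integer as ℤ
open import Data.Integer.DivMod using (_%ℕ_; _/ℕ_; n%ℕd<d; a≡a%ℕn+[a/ℕn]*n)
open import Data.Integer.Divisibility using (_∣_)
open import Data.Integer.Divisibility.Signed as ℤ∣ using (∣ᵤ⇒∣; ∣⇒∣ᵤ)
import Data.Integer.Properties as ℤₚ
open import Data.Integer.Tactic.RingSolver using (solve-∀)
open import Data.List using (List; []; _∷_; map)
open import Data.List.Membership.Propositional using (_∈_)
open import Data.List.Membership.Propositional.Properties using (∈-AllPairs₂)
open import Data.List.Relation.Unary.All as All using (_∷_)
open import Data.List.Relation.Unary.All.Properties using (¬Any⇒All¬)
open import Data.List.Relation.Unary.AllPairs using (_∷_)
open import Data.List.Relation.Unary.Any using (here; there; any?)
open import Data.List.Relation.Unary.Unique.Propositional using (Unique)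
open import Data.Nat as ℕ using (ℕ; zero; suc; NonZero; z≤n; s≤s; z<s; s<s)
import Data.Nat.Divisibility as ℕ∣
open import Data.Nat.ListAction using (sum)
import Data.Nat.Properties as ℕₚ
open import Data.Nat.Tactic.RingSolver using () renaming (solve-∀ to ℕ-solve-∀)
open import Data.Product using (_×_; _,_; ∃-syntax; proj₁; proj₂)
open import Data.Sum using (_⊎_; inj₁; inj₂)
open import Function using (_∘_)
open import Relation.Binary.Definitions using (DecidableEquality; tri<; tri≈; tri>)
open import Relation.Binary.PropositionalEquality
open import Relation.Nullary using (¬_; Dec; yes; no; contradiction)
open import Defs

-- The universal cover

-- Counting works because a fan telescopes. Let `g` be the value next to a vertex `c`, and let `r`
-- edges at `c` be shorter than the edge from `c` to `y`. Then `g = f y + r * f c`: each triangle of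
-- the fan contributes one copy of `f c`. Applied on both sides of `c` and subtracted from the
-- recurrence, this leaves the coefficient `a c - r - l`, where `l` counts the shorter edges on the
-- other side. Boundary segments count as edges, so every fan begins with one.
--
-- Away from the bridging vertices the row has no uniform closed form, and the second difference
-- avoids the need for one: only zeros have to be propagated. The input is that a period contains a
-- number of bridging vertices that does not depend on the row, so each shift by `n` along the
-- progression adds the same amount. Positivity of the frieze enters once, to divide in the
-- derivation of the recurrence.
--
-- In the universal cover crossing is interleaving of integers, and an edge is a start with a length
-- from 1 to `n`. Loops are the edges of length `n` when `n` exceeds 1, and neither they nor `n = 1`
-- form a separate case.

infixl 6 _⊕_
_⊕_ : ℤ → ℕ → ℤ
x ⊕ k = x + + k

opaque
  ⊕-assoc : ∀ x j k → x ⊕ j ⊕ k ≡ x ⊕ (j ℕ.+ k)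
  ⊕-assoc x j k = ℤₚ.+-assoc x (+ j) (+ k)

  x+k-k : ∀ x k → x ⊕ k - + k ≡ x
  x+k-k x k = lemma x (+ k)
    where
    lemma : ∀ x k → x + k - k ≡ x
    lemma = solve-∀

  x-k+k : ∀ x k → (x - + k) ⊕ k ≡ x
  x-k+k x k = lemma x (+ k)
    where
    lemma : ∀ x k → x - k + k ≡ x
    lemma = solve-∀

  ≤⇒⊕ : ∀ {a b} → a ≤ b → ∃[ k ] b ≡ a ⊕ k
  ≤⇒⊕ {a} {b} a≤b = ∣ b - a ∣ , (begin
    b                   ≡⟨ lemma a b ⟩
    a + (b - a)         ≡⟨ cong (_+_ a) (sym (ℤₚ.0≤i⇒+∣i∣≡i (ℤₚ.i≤j⇒0≤j-i a≤b))) ⟩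
    a + + ∣ b - a ∣     ∎)
    where
    open ≡-Reasoning
    lemma : ∀ a b → b ≡ a + (b - a)
    lemma = solve-∀

  ⊕-mono-≤ : ∀ x {j k} → j ℕ.≤ k → x ⊕ j ≤ x ⊕ k
  ⊕-mono-≤ x p = ℤₚ.+-monoʳ-≤ x (ℤ.+≤+ p)

  ⊕-mono-< : ∀ x {j k} → j ℕ.< k → x ⊕ j < x ⊕ k
  ⊕-mono-< x p = ℤₚ.+-monoʳ-< x (ℤ.+<+ p)

  ⊕-cancel-≤ : ∀ x {j k} → x ⊕ j ≤ x ⊕ k → j ℕ.≤ k
  ⊕-cancel-≤ x p = ℕₚ.≮⇒≥ λ k<j → ℤₚ.<⇒≱ (⊕-mono-< x k<j) p

  ⊕-cancel-< : ∀ x {j k} → x ⊕ j < x ⊕ k → j ℕ.< k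
  ⊕-cancel-< x p = ℕₚ.≰⇒> λ k≤j → ℤₚ.≤⇒≯ (⊕-mono-≤ x k≤j) p

  x<x⊕k : ∀ x {k} → 0 ℕ.< k → x < x ⊕ k
  x<x⊕k x {k} p = subst (_< x ⊕ k) (ℤₚ.+-identityʳ x) (⊕-mono-< x p)

  x<x⊕k⇒0<k : ∀ x {k} → x < x ⊕ k → 0 ℕ.< k
  x<x⊕k⇒0<k x {k} p = ⊕-cancel-< x (subst (_< x ⊕ k) (sym (ℤₚ.+-identityʳ x)) p)

module Cover (n : ℕ) .{{n≢0 : NonZero n}} where

  0<n : 0 ℕ.< n
  0<n = ℕ.>-nonZero⁻¹ n

  opaque
    private
      remainder-congruent : ∀ x r q → x - + 1 ≡ + r + q * + n → + n ∣ x - + suc r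
      remainder-congruent x r q eq = ∣⇒∣ᵤ (ℤ∣.divides q (begin
        x - + suc r              ≡⟨ shift x (+ r) ⟩
        (x - + 1) - + r          ≡⟨ cong (_- + r) eq ⟩
        (+ r + q * + n) - + r    ≡⟨ cancel (+ r) (q * + n) ⟩
        q * + n                  ∎))
        where
        open ≡-Reasoning
        shift : ∀ x r → x - (+ 1 + r) ≡ (x - + 1) - r
        shift = solve-∀
        cancel : ∀ r y → (r + y) - r ≡ y
        cancel = solve-∀

    point : ℤ → Point n
    -- Labels start at 1 while `Fin n` starts at 0, hence the remainder of `x - 1`.
    point x = fromℕ< (n%ℕd<d (x - + 1) n)

    point-over : ∀ x → x Over point x
    point-over x = subst (λ r → + n ∣ x - + suc r) (sym (Finₚ.toℕ-fromℕ< (n%ℕd<d (x - + 1) n)))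
      (remainder-congruent x ((x - + 1) %ℕ n) ((x - + 1) /ℕ n) (a≡a%ℕn+[a/ℕn]*n (x - + 1) n))

  opaque
    over-shift : ∀ x y (p : Point n) → + n ∣ x - y → y Over p → x Over p
    over-shift x y p x~y y-p = ∣⇒∣ᵤ (subst (+ n ℤ∣.∣_) (lemma x y (label p))
      (ℤ∣.∣m∣n⇒∣m+n (∣ᵤ⇒∣ {+ n} {x - y} x~y) (∣ᵤ⇒∣ {+ n} {y - label p} y-p)))
      where
      lemma : ∀ x y l → (x - y) + (y - l) ≡ x - l
      lemma = solve-∀

    over-congruent : ∀ x y (p : Point n) → x Over p → y Over p → + n ∣ x - y
    over-congruent x y p x-p y-p = ∣⇒∣ᵤ (subst (+ n ℤ∣.∣_) (lemma x y (label p))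
      (ℤ∣.∣m∣n⇒∣m-n (∣ᵤ⇒∣ {+ n} {x - label p} x-p) (∣ᵤ⇒∣ {+ n} {y - label p} y-p)))
      where
      lemma : ∀ x y l → (x - l) - (y - l) ≡ x - y
      lemma = solve-∀

    private
      over-unique-≤ : ∀ x (p q : Point n) → x Over p → x Over q → toℕ p ℕ.≤ toℕ q → p ≡ q
      over-unique-≤ x p q x-p x-q p≤q with ℕₚ.m≤n⇒∃[o]m+o≡n p≤q
      ... | zero  , eq = Finₚ.toℕ-injective (trans (sym (ℕₚ.+-identityʳ _)) eq)
      ... | suc d , eq = contradiction (ℕ∣.∣⇒≤ n∣d) (ℕₚ.<⇒≱ d<n)
        where
        lemma : ∀ x p d → (x - (+ 1 + p)) - (x - (+ 1 + (p + d))) ≡ d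
        lemma = solve-∀
        n∣d : n ℕ∣.∣ suc d
        n∣d = ∣⇒∣ᵤ (subst (+ n ℤ∣.∣_)
          (trans (cong (λ t → (x - label p) - (x - + suc t)) (sym eq)) (lemma x (+ toℕ p) (+ suc d)))
          (ℤ∣.∣m∣n⇒∣m-n (∣ᵤ⇒∣ {+ n} {x - label p} x-p) (∣ᵤ⇒∣ {+ n} {x - label q} x-q)))
        d<n : suc d ℕ.< n
        d<n = ℕₚ.≤-<-trans (subst (suc d ℕ.≤_) eq (ℕₚ.m≤n+m (suc d) (toℕ p))) (Finₚ.toℕ<n q)

    over-unique : ∀ x (p q : Point n) → x Over p → x Over q → p ≡ q
    over-unique x p q x-p x-q with ℕₚ.≤-total (toℕ p) (toℕ q)
    ... | inj₁ p≤q = over-unique-≤ x p q x-p x-q p≤q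
    ... | inj₂ q≤p = sym (over-unique-≤ x q p x-q x-p q≤p)

    over⇒point : ∀ x p → x Over p → point x ≡ p
    over⇒point x p x-p = over-unique x _ p (point-over x) x-p

    point⇒over : ∀ {x p} → point x ≡ p → x Over p
    point⇒over {x} refl = point-over x

    congruent⇒point : ∀ x y → + n ∣ x - y → point x ≡ point y
    congruent⇒point x y x~y = over⇒point x _ (over-shift x y _ x~y (point-over y))

    point⇒congruent : ∀ x y → point x ≡ point y → + n ∣ x - y
    point⇒congruent x y eq = over-congruent x y _ (point⇒over eq) (point-over y)

    point-cong : ∀ {x y} z → point x ≡ point y → point (x + z) ≡ point (y + z)
    point-cong {x} {y} z eq =
      congruent⇒point _ _ (subst (+ n ∣_) (lemma x y z) (point⇒congruent x y eq))
      where
      lemma : ∀ x y z → x - y ≡ (x + z) - (y + z)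
      lemma = solve-∀

    point-period : ∀ x → point (x ⊕ n) ≡ point x
    point-period x = congruent⇒point _ _ (subst (+ n ∣_) (lemma x (+ n)) ℕ∣.∣-refl)
      where
      lemma : ∀ x n → n ≡ (x + n) - x
      lemma = solve-∀

    point-label : ∀ (p : Point n) → point (label p) ≡ p
    point-label p =
      over⇒point _ _ (subst (+ n ∣_) (sym (ℤₚ.+-inverseʳ (label p))) (n ℕ∣.∣0))

    -- Congruent positions differ by a multiple of `n`, but here the difference lies strictly
    -- between 0 and `n`.
    point-⊕-injective-< : ∀ x {j k} → j ℕ.< k → k ℕ.< j ℕ.+ n → point (x ⊕ j) ≢ point (x ⊕ k)
    point-⊕-injective-< x {j} j<k k<j+n eq with ℕₚ.m≤n⇒∃[o]m+o≡n (ℕₚ.<⇒≤ j<k)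
    ... | zero  , refl = ℕₚ.<-irrefl (sym (ℕₚ.+-identityʳ j)) j<k
    ... | suc d , refl =
      contradiction (ℕ∣.∣⇒≤ n∣d) (ℕₚ.<⇒≱ (ℕₚ.+-cancelˡ-< j _ _ k<j+n))
      where
      lemma : ∀ x j d → (x + (j + d)) - (x + j) ≡ d
      lemma = solve-∀
      n∣d : n ℕ∣.∣ suc d
      n∣d = subst (+ n ∣_) (lemma x (+ j) (+ suc d)) (point⇒congruent _ _ (sym eq))

    point-⊕-injective : ∀ x {j k} → 0 ℕ.< j → j ℕ.≤ n → 0 ℕ.< k → k ℕ.≤ n →
                        point (x ⊕ j) ≡ point (x ⊕ k) → j ≡ k
    point-⊕-injective x {j} {k} 0<j j≤n 0<k k≤n eq with ℕₚ.<-cmp j k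
    ... | tri< j<k _ _ =
          contradiction eq (point-⊕-injective-< x j<k (ℕₚ.≤-<-trans k≤n (ℕₚ.m<n+m n 0<j)))
    ... | tri≈ _ j≡k _ = j≡k
    ... | tri> _ _ k<j =
          contradiction (sym eq) (point-⊕-injective-< x k<j (ℕₚ.≤-<-trans j≤n (ℕₚ.m<n+m n 0<k)))

-- Edges of the lifted triangulation

_≟ᵃ_ : ∀ {n} → DecidableEquality (Arc n)
bridging i ≟ᵃ bridging j with i Finₚ.≟ j
... | yes refl = yes refl
... | no  i≢j  = no λ { refl → i≢j refl }
bridging _ ≟ᵃ peripheral _ _ _ = no λ ()
peripheral _ _ _ ≟ᵃ bridging _ = no λ ()
peripheral i j _ ≟ᵃ peripheral k l _ with i Finₚ.≟ k | j Finₚ.≟ l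
... | yes refl | yes refl = yes refl
... | no  i≢k  | _        = no λ { refl → i≢k refl }
... | yes _    | no j≢l   = no λ { refl → j≢l refl }

_∈?_ : ∀ {n} (α : Arc n) Π → Dec (α ∈ Π)
α ∈? Π = any? (α ≟ᵃ_) Π

module Edges (n : ℕ) {{n≢0 : NonZero n}} (Π : List (Arc n)) (T : IsTriangulation Π) where
  open Cover n
  open IsTriangulation T

  -- The edge (x , k) joins x to x + k in the universal cover.
  data Edge (x : ℤ) : ℕ → Set where
    boundary : Edge x 1
    arc      : ∀ {k} → 1 ℕ.< k → k ℕ.≤ n →
               .(nb : ¬ IsBoundarySegment (point x) (point (x ⊕ k))) →
               peripheral (point x) (point (x ⊕ k)) nb ∈ Π → Edge x k

  Bridge : ℤ → Set
  Bridge x = bridging (point x) ∈ Π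

  edge-pos : ∀ {x k} → Edge x k → 0 ℕ.< k
  edge-pos boundary = z<s
  edge-pos (arc 1<k _ _ _) = ℕₚ.<-trans z<s 1<k

  edge-≤n : ∀ {x k} → Edge x k → k ℕ.≤ n
  edge-≤n boundary = 0<n
  edge-≤n (arc _ k≤n _ _) = k≤n

  boundary⇒≡1 : ∀ x {k} → 0 ℕ.< k → k ℕ.≤ n → IsBoundarySegment (point x) (point (x ⊕ k)) → k ≡ 1
  boundary⇒≡1 x {k} 0<k k≤n bd = sym (point-⊕-injective x z<s 0<n 0<k k≤n (begin
    point (x ⊕ 1)                   ≡⟨ point-cong (+ 1) (sym (point-label (point x))) ⟩
    point (label (point x) ⊕ 1)     ≡⟨ over⇒point _ _ bd ⟩
    point (x ⊕ k)                   ∎))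
    where open ≡-Reasoning

  isBoundary : ∀ x → IsBoundarySegment (point x) (point (x ⊕ 1))
  isBoundary x = point⇒over {label (point x) ⊕ 1} (point-cong (+ 1) (point-label (point x)))

  arc⇒edge : ∀ y {k p q} .{nb : ¬ IsBoundarySegment p q} → peripheral p q nb ∈ Π →
             point y ≡ p → point (y ⊕ k) ≡ q → 0 ℕ.< k → k ℕ.≤ n → Edge y k
  -- At length 1 the boundary segment joins the required ends; a genuine arc cannot have this
  -- length, since `isBoundary` would contradict `nb`.
  arc⇒edge y {suc zero}    α∈Π refl refl _ _ = boundary
  arc⇒edge y {suc (suc k)} {nb = nb} α∈Π refl refl _ k≤n = arc (s<s z<s) k≤n nb α∈Π

  edge-cong : ∀ {x y k} → point x ≡ point y → Edge x k → Edge y k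
  edge-cong eq boundary = boundary
  edge-cong {x} {y} {k} eq (arc 1<k k≤n nb α∈Π) =
    arc⇒edge y α∈Π (sym eq) (point-cong (+ k) (sym eq)) (ℕₚ.<-trans z<s 1<k) k≤n

  bridge-cong : ∀ {x y} → point x ≡ point y → Bridge x → Bridge y
  bridge-cong eq = subst (λ p → bridging p ∈ Π) eq

  lift : ∀ x k → 0 ℕ.< k → k ℕ.≤ n → IsLift (point x) (point (x ⊕ k)) x (x ⊕ k)
  lift x k 0<k k≤n = point-over x , point-over (x ⊕ k) , x<x⊕k x 0<k , ⊕-mono-≤ x k≤n

  lift⁻ : ∀ i j a b → IsLift i j a b →
          ∃[ k ] b ≡ a ⊕ k × 0 ℕ.< k × k ℕ.≤ n × point a ≡ i × point (a ⊕ k) ≡ j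
  lift⁻ i j a b (a-i , b-j , a<b , b≤a+n) with ≤⇒⊕ (ℤₚ.<⇒≤ a<b)
  ... | k , refl = k , refl , x<x⊕k⇒0<k a a<b , ⊕-cancel-≤ a b≤a+n ,
                   over⇒point a i a-i , over⇒point (a ⊕ k) j b-j

  -- `nonCrossing` excludes a crossing only in the order in which the two arcs stand in the list.
  -- That order is unknown, so both directions are needed for a contradiction.
  compatible : ∀ {α β} → α ∈ Π → β ∈ Π → α ≢ β → ¬ (Crosses α β × Crosses β α)
  compatible α∈Π β∈Π α≢β (αβ , βα) with ∈-AllPairs₂ nonCrossing α∈Π β∈Π
  ... | inj₁ α≡β        = α≢β α≡β
  ... | inj₂ (inj₁ ¬αβ) = ¬αβ αβ
  ... | inj₂ (inj₂ ¬βα) = ¬βα βα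

  edges-noncrossing : ∀ {x k j k′} → Edge x k → Edge (x ⊕ j) k′ →
                      0 ℕ.< j → j ℕ.< k → k ℕ.< j ℕ.+ k′ → ⊥
  edges-noncrossing boundary _ 0<j j<1 _ = ℕₚ.<⇒≱ 0<j (ℕₚ.<⇒≤pred j<1)
  edges-noncrossing {k = k} {j} (arc _ _ _ _) boundary _ j<k k<j+1 =
    ℕₚ.<⇒≱ j<k (ℕₚ.<⇒≤pred (subst (k ℕ.<_) (ℕₚ.+-comm j 1) k<j+1))
  edges-noncrossing {x} {k} {j} {k′} (arc 1<k k≤n nb α∈Π) (arc 1<k′ k′≤n nb′ β∈Π) 0<j j<k k<j+k′ =
    compatible α∈Π β∈Π α≢β
      ( (x , x ⊕ k , x ⊕ j , x ⊕ j ⊕ k′ , lx , ly , inj₁ (c₁ , c₂ , c₃))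
      , (x ⊕ j , x ⊕ j ⊕ k′ , x , x ⊕ k , ly , lx , inj₂ (c₁ , c₂ , c₃)))
    where
    lx = lift x k (ℕₚ.<-trans z<s 1<k) k≤n
    ly = lift (x ⊕ j) k′ (ℕₚ.<-trans z<s 1<k′) k′≤n
    c₁ = x<x⊕k x 0<j
    c₂ = ⊕-mono-< x j<k
    c₃ = subst (x ⊕ k <_) (sym (⊕-assoc x j k′)) (⊕-mono-< x k<j+k′)
    sources : ∀ {i j k l : Point n} .{p q} → peripheral i j p ≡ peripheral k l q → i ≡ k
    sources refl = refl
    -- Interleaving lifts belong to different arcs: lifts of one arc start a multiple of `n` apart,
    -- whereas `0 < j < n`.
    α≢β : peripheral (point x) (point (x ⊕ k)) nb ≢
          peripheral (point (x ⊕ j)) (point (x ⊕ j ⊕ k′)) nb′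
    α≢β eq = point-⊕-injective-< x 0<j (ℕₚ.<-≤-trans j<k k≤n)
      (trans (cong point (ℤₚ.+-identityʳ x)) (sources eq))

  bridge-noncrossing : ∀ {x k j} → Edge x k → Bridge (x ⊕ j) → 0 ℕ.< j → j ℕ.< k → ⊥
  bridge-noncrossing boundary _ 0<j j<1 = ℕₚ.<⇒≱ 0<j (ℕₚ.<⇒≤pred j<1)
  bridge-noncrossing {x} {k} {j} (arc 1<k k≤n nb α∈Π) β∈Π 0<j j<k =
    compatible α∈Π β∈Π (λ ()) (crossing , crossing)
    where
    crossing : BridgeCrosses (point (x ⊕ j)) (point x) (point (x ⊕ k))
    crossing = x , x ⊕ k , x ⊕ j , lift x k (ℕₚ.<-trans z<s 1<k) k≤n , point-over (x ⊕ j) ,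
               x<x⊕k x 0<j , ⊕-mono-< x j<k

  -- This is where maximality enters: otherwise `α` could be adjoined to `Π`. It is put at the head
  -- of the list, so it is tested only as the first argument of `Crosses`.
  uncrossed⇒∈ : ∀ α → (∀ {β} → β ∈ Π → ¬ Crosses α β) → α ∈ Π
  uncrossed⇒∈ α unc with α ∈? Π
  ... | yes α∈Π = α∈Π
  ... | no  α∉Π = maximal (α ∷ Π) (¬Any⇒All¬ Π α∉Π ∷ unique)
                    (All.tabulate unc ∷ nonCrossing) there (here refl)

  bridge-crosses⁻ : ∀ p i j → BridgeCrosses p i j →
    ∃[ y ] ∃[ l ] ∃[ k ] 0 ℕ.< l × l ℕ.< k × k ℕ.≤ n ×
      point y ≡ i × point (y ⊕ k) ≡ j × point (y ⊕ l) ≡ p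
  bridge-crosses⁻ p i j (a , b , c , lab , c-p , a<c , c<b) =
    go (lift⁻ i j a b lab) (≤⇒⊕ (ℤₚ.<⇒≤ a<c))
    where
    go : (∃[ k ] b ≡ a ⊕ k × 0 ℕ.< k × k ℕ.≤ n × point a ≡ i × point (a ⊕ k) ≡ j) →
         (∃[ l ] c ≡ a ⊕ l) → _
    go (k , refl , _ , k≤n , a-i , b-j) (l , refl) =
      a , l , k , x<x⊕k⇒0<k a a<c , ⊕-cancel-< a c<b , k≤n , a-i , b-j , over⇒point c p c-p

  -- All four endpoints are measured from the start `y` of one lift, which turns a crossing into
  -- inequalities between natural numbers.
  Interleaved : (i j p q : Point n) → Set
  Interleaved i j p q = ∃[ y ] ∃[ l ] ∃[ k ] ∃[ k′ ]
    0 ℕ.< l × l ℕ.< k × k ℕ.< l ℕ.+ k′ × k ℕ.≤ n × k′ ℕ.≤ n ×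
    point y ≡ i × point (y ⊕ k) ≡ j × point (y ⊕ l) ≡ p × point (y ⊕ l ⊕ k′) ≡ q

  lifts-interleave : ∀ i j p q {a b c d} → IsLift i j a b → IsLift p q c d →
                a < c → c < b → b < d → Interleaved i j p q
  lifts-interleave i j p q {a} {b} {c} {d} lab lcd a<c c<b b<d =
    go (lift⁻ i j a b lab) (lift⁻ p q c d lcd) (≤⇒⊕ (ℤₚ.<⇒≤ a<c))
    where
    go : (∃[ k ] b ≡ a ⊕ k × 0 ℕ.< k × k ℕ.≤ n × point a ≡ i × point (a ⊕ k) ≡ j) →
         (∃[ k ] d ≡ c ⊕ k × 0 ℕ.< k × k ℕ.≤ n × point c ≡ p × point (c ⊕ k) ≡ q) →
         (∃[ l ] c ≡ a ⊕ l) → Interleaved i j p q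
    go (k , refl , _ , k≤n , a-i , b-j) (k′ , refl , _ , k′≤n , c-p , d-q) (l , refl) =
      a , l , k , k′ , x<x⊕k⇒0<k a a<c , ⊕-cancel-< a c<b ,
      ⊕-cancel-< a (subst (a ⊕ k <_) (⊕-assoc a l k′) b<d) , k≤n , k′≤n , a-i , b-j , c-p , d-q

  module _ {x k} (1<k : 1 ℕ.< k) (k≤n : k ℕ.≤ n)
    (noBridge : ∀ {j} → 0 ℕ.< j → j ℕ.< k → ¬ Bridge (x ⊕ j))
    (noRight  : ∀ {j k′} → 0 ℕ.< j → j ℕ.< k → k ℕ.< j ℕ.+ k′ → ¬ Edge (x ⊕ j) k′)
    (noLeft   : ∀ {y j k′} → y ⊕ j ≡ x → 0 ℕ.< j → j ℕ.< k′ → k′ ℕ.< j ℕ.+ k → ¬ Edge y k′)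
    where

    private
      0<k : 0 ℕ.< k
      0<k = ℕₚ.<-trans z<s 1<k

      -- Lengths run through the window from 1 to `n`, one full period, so the residues of the two
      -- ends fix the length: all lifts of the arc look like the one at `x`.
      length≡ : ∀ a k₁ → point a ≡ point x → 0 ℕ.< k₁ → k₁ ℕ.≤ n →
                point (a ⊕ k₁) ≡ point (x ⊕ k) → k₁ ≡ k
      length≡ a k₁ eq 0<k₁ k₁≤n eq′ = point-⊕-injective x 0<k₁ k₁≤n 0<k k≤n
        (trans (point-cong (+ k₁) (sym eq)) eq′)

      uncrossed-bridge : ∀ p → bridging p ∈ Π → ¬ BridgeCrosses p (point x) (point (x ⊕ k))
      uncrossed-bridge p p∈Π cr with bridge-crosses⁻ _ _ _ cr
      ... | y , l , k₁ , 0<l , l<k₁ , k₁≤n , y-x , yk-xk , refl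
        with length≡ y k₁ y-x (ℕₚ.<-trans 0<l l<k₁) k₁≤n yk-xk
      ... | refl = noBridge 0<l l<k₁ (bridge-cong (point-cong (+ l) y-x) p∈Π)

      uncrossed-right : ∀ p q .(nb : ¬ IsBoundarySegment p q) → peripheral p q nb ∈ Π →
                        ¬ Interleaved (point x) (point (x ⊕ k)) p q
      uncrossed-right p q nb β∈Π (y , l , k₁ , k′ , 0<l , l<k₁ , k₁<l+k′ , k₁≤n , k′≤n ,
                                  y-x , yk-xk , yl-p , ylk-q)
        with length≡ y k₁ y-x (ℕₚ.<-trans 0<l l<k₁) k₁≤n yk-xk
      ... | refl = noRight 0<l l<k₁ k₁<l+k′ (edge-cong (point-cong (+ l) y-x)
              (arc⇒edge (y ⊕ l) β∈Π yl-p ylk-q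
                (ℕₚ.+-cancelˡ-< l 0 k′ (subst (ℕ._< l ℕ.+ k′) (sym (ℕₚ.+-identityʳ l))
                  (ℕₚ.<-trans l<k₁ k₁<l+k′))) k′≤n))

      uncrossed-left : ∀ p q .(nb : ¬ IsBoundarySegment p q) → peripheral p q nb ∈ Π →
                       ¬ Interleaved p q (point x) (point (x ⊕ k))
      uncrossed-left p q nb β∈Π (y , l , k′ , k₁ , 0<l , l<k′ , k′<l+k₁ , k′≤n , k₁≤n ,
                                 y-p , yk-q , yl-x , ylk-xk)
        with length≡ (y ⊕ l) k₁ yl-x
               (ℕₚ.+-cancelˡ-< l 0 k₁ (subst (ℕ._< l ℕ.+ k₁) (sym (ℕₚ.+-identityʳ l))
                  (ℕₚ.<-trans l<k′ k′<l+k₁))) k₁≤n ylk-xk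
      -- The crossing edge is moved by a multiple of `n`, so that the lift it crosses starts at `x`
      -- itself.
      ... | refl = noLeft {y = x - + l} (x-k+k x l) 0<l l<k′ k′<l+k₁
              (edge-cong (trans (cong point (sym (x+k-k y l))) (point-cong (- + l) yl-x))
                (arc⇒edge y β∈Π y-p yk-q (ℕₚ.<-trans 0<l l<k′) k′≤n))

      uncrossed : ∀ .(nb : ¬ IsBoundarySegment (point x) (point (x ⊕ k))) β → β ∈ Π →
                  ¬ Crosses (peripheral (point x) (point (x ⊕ k)) nb) β
      uncrossed nb (bridging p) β∈Π cr = uncrossed-bridge p β∈Π cr
      uncrossed nb (peripheral p q nb′) β∈Π (_ , _ , _ , _ , l , l′ , inj₁ (c₁ , c₂ , c₃)) =
        uncrossed-right p q nb′ β∈Π (lifts-interleave _ _ _ _ l l′ c₁ c₂ c₃)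
      uncrossed nb (peripheral p q nb′) β∈Π (_ , _ , _ , _ , l , l′ , inj₂ (c₁ , c₂ , c₃)) =
        uncrossed-left p q nb′ β∈Π (lifts-interleave _ _ _ _ l′ l c₁ c₂ c₃)

      nonBoundary : ¬ IsBoundarySegment (point x) (point (x ⊕ k))
      nonBoundary bd = ℕₚ.<-irrefl (sym (boundary⇒≡1 x 0<k k≤n bd)) 1<k

    -- A segment can be crossed in three ways only: by a bridge from its interior, by an edge
    -- leaving its interior to the right, or by one entering it from the left. Periodicity reduces
    -- every crossing to one at the lift that starts at `x`.
    uncrossed⇒edge : Edge x k
    uncrossed⇒edge = arc 1<k k≤n nonBoundary (uncrossed⇒∈ _ (uncrossed nonBoundary _))

  -- Bridges never cross one another, so only an edge passing over `x` can keep the bridge at `x`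
  -- out of `Π`.
  uncrossed⇒bridge : ∀ {x} →
    (∀ {y j k} → y ⊕ j ≡ x → 0 ℕ.< j → j ℕ.< k → ¬ Edge y k) → Bridge x
  uncrossed⇒bridge {x} noEdge = uncrossed⇒∈ _ (uncrossed _)
    where
    uncrossed : ∀ β → β ∈ Π → ¬ Crosses (bridging (point x)) β
    uncrossed (bridging _) _ ()
    uncrossed (peripheral p q _) β∈Π cr with bridge-crosses⁻ _ _ _ cr
    ... | y , l , k , 0<l , l<k , k≤n , y-p , yk-q , yl-x =
      noEdge {y = x - + l} (x-k+k x l) 0<l l<k
        (edge-cong (trans (cong point (sym (x+k-k y l))) (point-cong (- + l) yl-x))
          (arc⇒edge y β∈Π y-p yk-q (ℕₚ.<-trans 0<l l<k) k≤n))

-- Counting arc ends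

Σ< : ℕ → (ℕ → ℕ) → ℕ
Σ< zero    f = 0
Σ< (suc n) f = Σ< n f ℕ.+ f n

Σ<-cong : ∀ n {f g} → (∀ d → f d ≡ g d) → Σ< n f ≡ Σ< n g
Σ<-cong zero    f≡g = refl
Σ<-cong (suc n) f≡g = cong₂ ℕ._+_ (Σ<-cong n f≡g) (f≡g n)

Σ<-zero : ∀ n {f} → (∀ {d} → d ℕ.< n → f d ≡ 0) → Σ< n f ≡ 0
Σ<-zero zero    f≡0 = refl
Σ<-zero (suc n) f≡0 = cong₂ ℕ._+_ (Σ<-zero n (f≡0 ∘ ℕₚ.m<n⇒m<1+n)) (f≡0 ℕₚ.≤-refl)

Σ<-+ : ∀ n f g → Σ< n (λ d → f d ℕ.+ g d) ≡ Σ< n f ℕ.+ Σ< n g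
Σ<-+ zero    f g = refl
Σ<-+ (suc n) f g = trans (cong (ℕ._+ (f n ℕ.+ g n)) (Σ<-+ n f g)) (lemma (Σ< n f) (Σ< n g) (f n) (g n))
  where
  lemma : ∀ a b c d → a ℕ.+ b ℕ.+ (c ℕ.+ d) ≡ a ℕ.+ c ℕ.+ (b ℕ.+ d)
  lemma = ℕ-solve-∀

Σ<-* : ∀ n c f → Σ< n (λ d → c ℕ.* f d) ≡ c ℕ.* Σ< n f
Σ<-* zero    c f = sym (ℕₚ.*-zeroʳ c)
Σ<-* (suc n) c f = trans (cong (ℕ._+ c ℕ.* f n) (Σ<-* n c f)) (sym (ℕₚ.*-distribˡ-+ c _ (f n)))

Σ<-truncate : ∀ n {k f} → k ℕ.≤ n → (∀ {d} → k ℕ.≤ d → d ℕ.< n → f d ≡ 0) → Σ< n f ≡ Σ< k f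
Σ<-truncate zero    {k} {f} k≤0   _   = cong (λ k → Σ< k f) (sym (ℕₚ.n≤0⇒n≡0 k≤0))
Σ<-truncate (suc n) {k} {f} k≤1+n f≡0 = split (ℕₚ.m≤n⇒m<n∨m≡n k≤1+n)
  where
  open ≡-Reasoning
  split : k ℕ.< suc n ⊎ k ≡ suc n → Σ< (suc n) f ≡ Σ< k f
  split (inj₂ eq)    = cong (λ k → Σ< k f) (sym eq)
  split (inj₁ k<1+n) = begin
    Σ< n f ℕ.+ f n  ≡⟨ cong (Σ< n f ℕ.+_) (f≡0 (ℕₚ.<⇒≤pred k<1+n) ℕₚ.≤-refl) ⟩
    Σ< n f ℕ.+ 0    ≡⟨ ℕₚ.+-identityʳ _ ⟩
    Σ< n f          ≡⟨ Σ<-truncate n (ℕₚ.<⇒≤pred k<1+n) (λ k≤d d<n → f≡0 k≤d (ℕₚ.m<n⇒m<1+n d<n)) ⟩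
    Σ< k f          ∎

Σ<-last : ∀ {k n f} → k ℕ.< n → f k ≡ 1 → (∀ {d} → k ℕ.< d → d ℕ.< n → f d ≡ 0) →
          Σ< n f ≡ suc (Σ< k f)
Σ<-last {k} {n} {f} k<n fk≡1 f≡0 = begin
  Σ< n f          ≡⟨ Σ<-truncate n k<n f≡0 ⟩
  Σ< k f ℕ.+ f k  ≡⟨ cong (Σ< k f ℕ.+_) fk≡1 ⟩
  Σ< k f ℕ.+ 1    ≡⟨ ℕₚ.+-comm _ 1 ⟩
  suc (Σ< k f)    ∎
  where open ≡-Reasoning

Σ<-unique : ∀ {k n f} → k ℕ.< n → f k ≡ 1 → (∀ {d} → d ℕ.< n → d ≢ k → f d ≡ 0) → Σ< n f ≡ 1
Σ<-unique {k} {n} {f} k<n fk≡1 f≡0 = trans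
  (Σ<-last k<n fk≡1 (λ k<d d<n → f≡0 d<n (ℕₚ.<⇒≢ k<d ∘ sym)))
  (cong suc (Σ<-zero k (λ d<k → f≡0 (ℕₚ.<-trans d<k k<n) (ℕₚ.<⇒≢ d<k))))

sum-zero : ∀ {A : Set} (g : A → ℕ) xs → (∀ {x} → x ∈ xs → g x ≡ 0) → sum (map g xs) ≡ 0
sum-zero g []       g≡0 = refl
sum-zero g (x ∷ xs) g≡0 = cong₂ ℕ._+_ (g≡0 (here refl)) (sum-zero g xs (g≡0 ∘ there))

sum-unique : ∀ {A : Set} (g : A → ℕ) {x xs} → Unique xs → x ∈ xs → g x ≡ 1 →
             (∀ {y} → y ≢ x → g y ≡ 0) → sum (map g xs) ≡ 1
sum-unique g {xs = _ ∷ xs} (x∉ ∷ _) (here refl) gx≡1 g≡0 =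
  cong₂ ℕ._+_ gx≡1 (sum-zero g xs λ y∈xs → g≡0 λ { refl → All.lookup x∉ y∈xs refl })
sum-unique g (y∉ ∷ u) (there x∈xs) gx≡1 g≡0 =
  cong₂ ℕ._+_ (g≡0 (All.lookup y∉ x∈xs)) (sum-unique g u x∈xs gx≡1 g≡0)

δ-≡ : ∀ {n} {i j : Point n} → i ≡ j → δ i j ≡ 1
δ-≡ {i = i} refl with i Finₚ.≟ i
... | yes _   = refl
... | no  i≢i = contradiction refl i≢i

δ-≢ : ∀ {n} {i j : Point n} → i ≢ j → δ i j ≡ 0
δ-≢ {i = i} {j} i≢j with i Finₚ.≟ j
... | yes i≡j = contradiction i≡j i≢j
... | no  _   = refl

isBridge : ∀ {n} → Point n → Arc n → ℕ
isBridge i (bridging j)       = δ i j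
isBridge i (peripheral _ _ _) = 0

-- The indicator looks at endpoints alone, so it can be summed over all pairs of points, including
-- boundary segments, which carry no arc.
isPeripheral : ∀ {n} → Point n → Point n → Arc n → ℕ
isPeripheral i j (bridging _)       = 0
isPeripheral i j (peripheral k l _) = δ i k ℕ.* δ j l

isPeripheral-≢ : ∀ {n} (i j : Point n) β → (∀ .nb → β ≢ peripheral i j nb) → isPeripheral i j β ≡ 0
isPeripheral-≢ i j (bridging _)         _   = refl
isPeripheral-≢ i j (peripheral k l nb) β≢α with i Finₚ.≟ k | j Finₚ.≟ l
... | no  _    | _        = refl
... | yes _    | no _     = refl
... | yes refl | yes refl = contradiction refl (β≢α nb)

isBridge-≢ : ∀ {n} (i : Point n) β → β ≢ bridging i → isBridge i β ≡ 0
isBridge-≢ i (bridging j)       β≢α = δ-≢ {i = i} λ { refl → β≢α refl }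
isBridge-≢ i (peripheral _ _ _) _   = refl

-- Every end of an arc at i is the source or the target of a peripheral arc whose
-- other end occurs exactly once in each of the enumerations r and l of the points.
ends-count : ∀ {n} (i : Point n) (r l : ℕ → Point n) →
  (∀ j → Σ< n (λ d → δ (r d) j) ≡ 1) → (∀ j → Σ< n (λ d → δ (l d) j) ≡ 1) → ∀ Π →
  sum (map (ends i) Π) ≡ sum (map (isBridge i) Π)
                         ℕ.+ Σ< n (λ d → sum (map (isPeripheral i (r d)) Π))
                         ℕ.+ Σ< n (λ d → sum (map (isPeripheral (l d) i) Π))
ends-count {n} i r l r! l! []       = sym (cong₂ ℕ._+_ (Σ<-zero n λ _ → refl) (Σ<-zero n λ _ → refl))
ends-count {n} i r l r! l! (α ∷ Π) = begin
  ends i α ℕ.+ sum (map (ends i) Π)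
    ≡⟨ cong₂ ℕ._+_ (single α) (ends-count i r l r! l! Π) ⟩
  isBridge i α ℕ.+ Σ< n p ℕ.+ Σ< n q ℕ.+ (B ℕ.+ Σ< n P ℕ.+ Σ< n Q)
    ≡⟨ lemma (isBridge i α) (Σ< n p) (Σ< n q) B (Σ< n P) (Σ< n Q) ⟩
  isBridge i α ℕ.+ B ℕ.+ (Σ< n p ℕ.+ Σ< n P) ℕ.+ (Σ< n q ℕ.+ Σ< n Q)
    ≡⟨ cong₂ (λ s t → isBridge i α ℕ.+ B ℕ.+ s ℕ.+ t) (sym (Σ<-+ n p P)) (sym (Σ<-+ n q Q)) ⟩
  isBridge i α ℕ.+ B ℕ.+ Σ< n (λ d → p d ℕ.+ P d) ℕ.+ Σ< n (λ d → q d ℕ.+ Q d) ∎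
  where
  open ≡-Reasoning
  p q P Q : ℕ → ℕ
  p d = isPeripheral i (r d) α
  q d = isPeripheral (l d) i α
  P d = sum (map (isPeripheral i (r d)) Π)
  Q d = sum (map (isPeripheral (l d) i) Π)
  B = sum (map (isBridge i) Π)
  lemma : ∀ a b c d e f → a ℕ.+ b ℕ.+ c ℕ.+ (d ℕ.+ e ℕ.+ f) ≡ a ℕ.+ d ℕ.+ (b ℕ.+ e) ℕ.+ (c ℕ.+ f)
  lemma = ℕ-solve-∀
  single : ∀ α → ends i α ≡ isBridge i α ℕ.+ Σ< n (λ d → isPeripheral i (r d) α)
                                         ℕ.+ Σ< n (λ d → isPeripheral (l d) i α)
  single (bridging j) = sym (trans
    (cong₂ (λ s t → δ i j ℕ.+ s ℕ.+ t) (Σ<-zero n λ _ → refl) (Σ<-zero n λ _ → refl))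
    (trans (ℕₚ.+-identityʳ _) (ℕₚ.+-identityʳ _)))
  single (peripheral j k _) = sym (cong₂ ℕ._+_
    (begin
      Σ< n (λ d → δ i j ℕ.* δ (r d) k)   ≡⟨ Σ<-* n (δ i j) _ ⟩
      δ i j ℕ.* Σ< n (λ d → δ (r d) k)   ≡⟨ cong (δ i j ℕ.*_) (r! k) ⟩
      δ i j ℕ.* 1                        ≡⟨ ℕₚ.*-identityʳ _ ⟩
      δ i j                              ∎)
    (begin
      Σ< n (λ d → δ (l d) j ℕ.* δ i k)   ≡⟨ Σ<-cong n (λ d → ℕₚ.*-comm (δ (l d) j) (δ i k)) ⟩
      Σ< n (λ d → δ i k ℕ.* δ (l d) j)   ≡⟨ Σ<-* n (δ i k) _ ⟩
      δ i k ℕ.* Σ< n (λ d → δ (l d) j)   ≡⟨ cong (δ i k ℕ.*_) (l! j) ⟩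
      δ i k ℕ.* 1                        ≡⟨ ℕₚ.*-identityʳ _ ⟩
      δ i k                              ∎))

module Enumerate (n : ℕ) .{{n≢0 : NonZero n}} where
  open Cover n

  opaque
    private
      shift-point : ∀ a q j → a ≡ label j + q * + n → point a ≡ j
      shift-point a q j eq = over⇒point a j (∣⇒∣ᵤ
        (ℤ∣.divides q (trans (cong (_- label j) eq) (lemma (label j) (q * + n)))))
        where
        lemma : ∀ l y → l + y - l ≡ y
        lemma = solve-∀

    forward : ∀ c (j : Point n) → ∃[ d ] d ℕ.< n × point (c ⊕ suc d) ≡ j
    forward c j = (label j - c - + 1) %ℕ n , n%ℕd<d (label j - c - + 1) n ,
      shift-point _ (- ((label j - c - + 1) /ℕ n)) j
        (lemma c (label j) (+ ((label j - c - + 1) %ℕ n)) ((label j - c - + 1) /ℕ n) (+ n)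
          (a≡a%ℕn+[a/ℕn]*n (label j - c - + 1) n))
      where
      lemma : ∀ c l r q m → l - c - + 1 ≡ r + q * m → c + (+ 1 + r) ≡ l + - q * m
      lemma c l r q m eq = trans (l₁ c r (q * m))
        (trans (cong (λ t → c + (+ 1 + (t - q * m))) (sym eq)) (l₂ c l q m))
        where
        l₁ : ∀ c r y → c + (+ 1 + r) ≡ c + (+ 1 + (r + y - y))
        l₁ = solve-∀
        l₂ : ∀ c l q m → c + (+ 1 + (l - c - + 1 - q * m)) ≡ l + - q * m
        l₂ = solve-∀

    backward : ∀ c (j : Point n) → ∃[ d ] d ℕ.< n × point (c - + suc d) ≡ j
    backward c j = (c - label j - + 1) %ℕ n , n%ℕd<d (c - label j - + 1) n ,
      shift-point _ ((c - label j - + 1) /ℕ n) j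
        (lemma c (label j) (+ ((c - label j - + 1) %ℕ n)) ((c - label j - + 1) /ℕ n) (+ n)
          (a≡a%ℕn+[a/ℕn]*n (c - label j - + 1) n))
      where
      lemma : ∀ c l r q m → c - l - + 1 ≡ r + q * m → c - (+ 1 + r) ≡ l + q * m
      lemma c l r q m eq = trans (l₁ c r (q * m))
        (trans (cong (λ t → c - (+ 1 + (t - q * m))) (sym eq)) (l₂ c l q m))
        where
        l₁ : ∀ c r y → c - (+ 1 + r) ≡ c - (+ 1 + (r + y - y))
        l₁ = solve-∀
        l₂ : ∀ c l q m → c - (+ 1 + (c - l - + 1 - q * m)) ≡ l + q * m
        l₂ = solve-∀

    point-⊖-injective : ∀ c {j k} → 0 ℕ.< j → j ℕ.≤ n → 0 ℕ.< k → k ℕ.≤ n →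
                        point (c - + j) ≡ point (c - + k) → j ≡ k
    point-⊖-injective c {j} {k} 0<j j≤n 0<k k≤n eq =
      point-⊕-injective c 0<j j≤n 0<k k≤n (begin
        point (c ⊕ j)                    ≡⟨ cong point (l₁ c (+ j) (+ k)) ⟩
        point (c - + k + (+ j + + k))    ≡⟨ point-cong (+ j + + k) (sym eq) ⟩
        point (c - + j + (+ j + + k))    ≡⟨ cong point (l₂ c (+ j) (+ k)) ⟩
        point (c ⊕ k)                    ∎)
      where
      open ≡-Reasoning
      l₁ : ∀ c j k → c + j ≡ c - k + (j + k)
      l₁ = solve-∀
      l₂ : ∀ c j k → c - j + (j + k) ≡ c + k
      l₂ = solve-∀

    -- The offsets `suc d` are the possible edge lengths 1 to `n`, a full set of residues. The base
    -- point itself is met at offset `n`, the length of a loop.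
    forward-unique : ∀ c (j : Point n) → Σ< n (λ d → δ (point (c ⊕ suc d)) j) ≡ 1
    forward-unique c j with forward c j
    ... | k , k<n , refl = Σ<-unique k<n (δ-≡ {i = point (c ⊕ suc k)} refl)
      (λ d<n d≢k → δ-≢ λ eq → d≢k (ℕₚ.suc-injective (point-⊕-injective c z<s d<n z<s k<n eq)))

    backward-unique : ∀ c (j : Point n) → Σ< n (λ d → δ (point (c - + suc d)) j) ≡ 1
    backward-unique c j with backward c j
    ... | k , k<n , refl = Σ<-unique k<n (δ-≡ {i = point (c - + suc k)} refl)
      (λ d<n d≢k → δ-≢ λ eq → d≢k (ℕₚ.suc-injective (point-⊖-injective c z<s d<n z<s k<n eq)))

-- Triangles and bridges

max-below : ∀ {P : ℕ → Set} → (∀ d → Dec (P d)) → ∀ N → P 0 →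
            ∃[ m ] m ℕ.≤ N × P m × (∀ {i} → m ℕ.< i → i ℕ.≤ N → ¬ P i)
max-below P? zero    p₀ = 0 , z≤n , p₀ , λ 0<i i≤0 _ → ℕₚ.<⇒≱ 0<i i≤0
max-below P? (suc N) p₀ with P? (suc N) | max-below P? N p₀
... | yes p | _ = suc N , ℕₚ.≤-refl , p , λ N<i i≤N _ → ℕₚ.<⇒≱ N<i i≤N
... | no ¬p | m , m≤N , pm , max = m , ℕₚ.m≤n⇒m≤1+n m≤N , pm , λ {i} m<i i≤1+N pi →
        case-≤ (ℕₚ.m≤n⇒m<n∨m≡n i≤1+N) m<i pi
  where
  case-≤ : ∀ {i} → i ℕ.< suc N ⊎ i ≡ suc N → m ℕ.< i → ¬ _
  case-≤ (inj₁ i<1+N) m<i pi = max m<i (ℕₚ.<⇒≤pred i<1+N) pi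
  case-≤ (inj₂ refl)  m<i pi = ¬p pi

least-below : ∀ {P : ℕ → Set} → (∀ d → Dec (P d)) → ∀ N → P N →
              ∃[ m ] m ℕ.≤ N × P m × (∀ {i} → i ℕ.< m → ¬ P i)
least-below P? zero    p = 0 , z≤n , p , λ ()
least-below {P} P? (suc N) p with P? 0
... | yes p₀ = 0 , z≤n , p₀ , λ ()
... | no ¬p₀ with least-below (P? ∘ suc) N p
...   | m , m≤N , pm , least = suc m , s≤s m≤N , pm ,
        λ { {zero} _ → ¬p₀ ; {suc i} i<m → least (ℕ.s<s⁻¹ i<m) }

⊕-cancelʳ : ∀ {x y} j → x ⊕ j ≡ y ⊕ j → x ≡ y
⊕-cancelʳ {x} {y} j eq = trans (sym (x+k-k x j)) (trans (cong (_- + j) eq) (x+k-k y j))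

module Fans (n : ℕ) {{n≢0 : NonZero n}} (Π : List (Arc n)) (T : IsTriangulation Π) where
  open Cover n
  open Enumerate n
  open Edges n Π T
  open IsTriangulation T using (unique)

  boundaryCount : ℕ → ℕ
  boundaryCount (suc zero) = 1
  boundaryCount _          = 0

  arcCount : Point n → Point n → ℕ
  arcCount i j = sum (map (isPeripheral i j) Π)

  edgeCount : ℤ → ℕ → ℕ
  edgeCount x k = arcCount (point x) (point (x ⊕ k)) ℕ.+ boundaryCount k

  -- `Π` is free of duplicates, so counting an arc gives 0 or 1. At length 1 no arc exists, and the
  -- count 1 comes from `boundaryCount`.
  edge-dichotomy : ∀ x k → 0 ℕ.< k → k ℕ.≤ n →
                   Edge x k × edgeCount x k ≡ 1 ⊎ ¬ Edge x k × edgeCount x k ≡ 0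
  edge-dichotomy x (suc zero) 0<k k≤n = inj₁ (boundary , cong (ℕ._+ 1) (sum-zero _ Π λ {β} _ →
    isPeripheral-≢ (point x) (point (x ⊕ 1)) β λ nb _ → ⊥-elim-irr (nb (isBoundary x))))
  edge-dichotomy x k@(suc (suc _)) 0<k k≤n with peripheral _ _ nb ∈? Π
    where
    nb : ¬ IsBoundarySegment (point x) (point (x ⊕ k))
    nb bd with boundary⇒≡1 x 0<k k≤n bd
    ... | ()
  ... | yes α∈Π = inj₁ (arc (s<s z<s) k≤n _ α∈Π , trans (ℕₚ.+-identityʳ _)
    (sum-unique _ unique α∈Π (cong₂ ℕ._*_ (δ-≡ {i = point x} refl) (δ-≡ {i = point (x ⊕ k)} refl))
      λ {β} β≢α → isPeripheral-≢ (point x) (point (x ⊕ k)) β λ _ → β≢α))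
  ... | no α∉Π = inj₂ ((λ { (arc _ _ _ α∈Π) → α∉Π α∈Π }) , trans (ℕₚ.+-identityʳ _)
    (sum-zero _ Π λ {β} β∈Π → isPeripheral-≢ (point x) (point (x ⊕ k)) β λ { _ refl → α∉Π β∈Π }))

  edge? : ∀ x k → Dec (Edge x k)
  edge? x zero = no λ e → ℕₚ.<-irrefl refl (edge-pos e)
  edge? x k@(suc _) with k ℕₚ.≤? n
  ... | no  k≰n = no (k≰n ∘ edge-≤n)
  ... | yes k≤n with edge-dichotomy x k z<s k≤n
  ...   | inj₁ (e , _)  = yes e
  ...   | inj₂ (¬e , _) = no ¬e

  edge⇒count : ∀ {x k} → Edge x k → edgeCount x k ≡ 1
  edge⇒count {x} {k} e with edge-dichotomy x k (edge-pos e) (edge-≤n e)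
  ... | inj₁ (_ , eq) = eq
  ... | inj₂ (¬e , _) = contradiction e ¬e

  ¬edge⇒count : ∀ {x k} → 0 ℕ.< k → k ℕ.≤ n → ¬ Edge x k → edgeCount x k ≡ 0
  ¬edge⇒count {x} {k} 0<k k≤n ¬e with edge-dichotomy x k 0<k k≤n
  ... | inj₁ (e , _)  = contradiction e ¬e
  ... | inj₂ (_ , eq) = eq

  bridge? : ∀ x → Dec (Bridge x)
  bridge? x = bridging (point x) ∈? Π

  bridgeCount : ℤ → ℕ
  bridgeCount x = sum (map (isBridge (point x)) Π)

  bridge⇒count : ∀ {x} → Bridge x → bridgeCount x ≡ 1
  bridge⇒count {x} b = sum-unique _ unique b (δ-≡ {i = point x} refl) λ {β} → isBridge-≢ (point x) β

  ¬bridge⇒count : ∀ {x} → ¬ Bridge x → bridgeCount x ≡ 0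
  ¬bridge⇒count {x} ¬b = sum-zero _ Π λ {β} β∈Π → isBridge-≢ (point x) β λ { refl → ¬b β∈Π }

  -- Used with `k` one less than the length of a given edge, these count the edges of the fan
  -- strictly below that edge.
  rightDegree leftDegree : ℤ → ℕ → ℕ
  rightDegree x k = Σ< k λ d → edgeCount x (suc d)
  leftDegree  x k = Σ< k λ d → edgeCount (x - + suc d) (suc d)

  Σ<-boundary : ∀ m .{{_ : NonZero m}} → Σ< m (λ d → boundaryCount (suc d)) ≡ 1
  Σ<-boundary m = Σ<-unique {0} {m} {λ d → boundaryCount (suc d)} (ℕ.>-nonZero⁻¹ m) refl
    λ { {zero} _ d≢0 → contradiction refl d≢0 ; {suc _} _ _ → refl }

  -- The quiddity exceeds the number of arc ends by 1, while the degrees also count the two boundary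
  -- segments at `x`; hence the extra `suc`.
  quiddity-degrees : ∀ x →
    suc (quiddity Π (point x)) ≡ bridgeCount x ℕ.+ rightDegree x n ℕ.+ leftDegree x n
  quiddity-degrees x = begin
    2 ℕ.+ sum (map (ends (point x)) Π)
      ≡⟨ cong (2 ℕ.+_) (ends-count (point x) _ _ (forward-unique x) (backward-unique x) Π) ⟩
    2 ℕ.+ (B ℕ.+ R ℕ.+ L)
      ≡⟨ lemma B R L ⟩
    B ℕ.+ (R ℕ.+ 1) ℕ.+ (L ℕ.+ 1)
      ≡⟨ cong₂ (λ s t → B ℕ.+ (R ℕ.+ s) ℕ.+ (L ℕ.+ t)) (sym (Σ<-boundary n)) (sym (Σ<-boundary n)) ⟩
    B ℕ.+ (R ℕ.+ Σ< n (boundaryCount ∘ suc)) ℕ.+ (L ℕ.+ Σ< n (boundaryCount ∘ suc))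
      ≡⟨ cong₂ (λ s t → B ℕ.+ s ℕ.+ t) (sym (Σ<-+ n _ _))
           (trans (sym (Σ<-+ n _ _)) (Σ<-cong n λ d →
             cong (λ y → arcCount (point (x - + suc d)) (point y) ℕ.+ boundaryCount (suc d))
               (sym (x-k+k x (suc d))))) ⟩
    B ℕ.+ rightDegree x n ℕ.+ leftDegree x n ∎
    where
    open ≡-Reasoning
    B = bridgeCount x
    R = Σ< n λ d → arcCount (point x) (point (x ⊕ suc d))
    L = Σ< n λ d → arcCount (point (x - + suc d)) (point x)
    lemma : ∀ b r l → 2 ℕ.+ (b ℕ.+ r ℕ.+ l) ≡ b ℕ.+ (r ℕ.+ 1) ℕ.+ (l ℕ.+ 1)
    lemma = ℕ-solve-∀

  rightDegree-last : ∀ {x k m} → k ℕ.< m → m ℕ.≤ n → Edge x (suc k) →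
    (∀ {d} → k ℕ.< d → d ℕ.< m → ¬ Edge x (suc d)) → rightDegree x m ≡ suc (rightDegree x k)
  rightDegree-last k<m m≤n e none = Σ<-last k<m (edge⇒count e)
    λ k<d d<m → ¬edge⇒count z<s (ℕₚ.≤-trans d<m m≤n) (none k<d d<m)

  leftDegree-last : ∀ {x y k m} → k ℕ.< m → m ℕ.≤ n → Edge x (suc k) → y ≡ x ⊕ suc k →
    (∀ {d z} → k ℕ.< d → d ℕ.< m → z ⊕ suc d ≡ y → ¬ Edge z (suc d)) →
    leftDegree y m ≡ suc (leftDegree y k)
  leftDegree-last {x} {k = k} k<m m≤n e refl none = Σ<-last k<m
    (trans (cong (λ z → edgeCount z (suc k)) (x+k-k x (suc k))) (edge⇒count e))
    λ {d} k<d d<m → ¬edge⇒count z<s (ℕₚ.≤-trans d<m m≤n) (none k<d d<m (x-k+k _ (suc d)))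

  module _ {x j k} (e₁ : Edge x (suc j)) (e₂ : Edge (x ⊕ suc j) (suc k)) where

    -- The hypotheses make `e₂` the longest edge starting at the apex and `e₁` the longest one
    -- ending there, so each full degree is one more than the number of shorter edges. In `noLeft`,
    -- `suc i` is the distance by which an edge would overshoot `x`.
    quiddity-fan :
      (∀ {d} → k ℕ.< d → ¬ Edge (x ⊕ suc j) (suc d)) →
      (∀ {i d y} → y ⊕ suc i ≡ x → d ≡ suc i ℕ.+ j → ¬ Edge y (suc d)) →
      suc (quiddity Π (point (x ⊕ suc j))) ≡
        bridgeCount (x ⊕ suc j) ℕ.+ suc (rightDegree (x ⊕ suc j) k) ℕ.+ suc (leftDegree (x ⊕ suc j) j)
    quiddity-fan noRight noLeft = trans (quiddity-degrees (x ⊕ suc j))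
      (cong₂ (λ r l → bridgeCount (x ⊕ suc j) ℕ.+ r ℕ.+ l)
        (rightDegree-last (edge-≤n e₂) ℕₚ.≤-refl e₂ λ k<d _ → noRight k<d)
        (leftDegree-last (edge-≤n e₁) ℕₚ.≤-refl e₁ refl λ j<d _ → left j<d))
      where
      left : ∀ {d y} → j ℕ.< d → y ⊕ suc d ≡ x ⊕ suc j → ¬ Edge y (suc d)
      left {d} {y} j<d eq with ℕₚ.m≤n⇒∃[o]m+o≡n j<d
      ... | i , refl = noLeft {i} (⊕-cancelʳ (suc j)
              (trans (⊕-assoc y (suc i) (suc j)) (trans (cong (y ⊕_) (lemma i j)) eq)))
              (lemma′ i j)
        where
        lemma : ∀ i j → suc i ℕ.+ suc j ≡ suc (suc j ℕ.+ i)
        lemma = ℕ-solve-∀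
        lemma′ : ∀ i j → suc j ℕ.+ i ≡ suc i ℕ.+ j
        lemma′ = ℕ-solve-∀

    -- The edge over the apex would be crossed by a bridge there, and by any edge at the apex longer
    -- than `e₁` or `e₂`.
    interior-quiddity : Edge x (suc j ℕ.+ suc k) →
      quiddity Π (point (x ⊕ suc j)) ≡ suc (rightDegree (x ⊕ suc j) k ℕ.+ leftDegree (x ⊕ suc j) j)
    interior-quiddity e = ℕₚ.suc-injective (begin
      suc (quiddity Π (point y))   ≡⟨ quiddity-fan noRight noLeft ⟩
      bridgeCount y ℕ.+ suc r ℕ.+ suc l
        ≡⟨ cong (λ b → b ℕ.+ suc r ℕ.+ suc l)
             (¬bridge⇒count λ b → bridge-noncrossing e b z<s (ℕₚ.m<m+n (suc j) z<s)) ⟩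
      suc r ℕ.+ suc l              ≡⟨ ℕₚ.+-suc (suc r) l ⟩
      suc (suc (r ℕ.+ l))          ∎)
      where
      open ≡-Reasoning
      y = x ⊕ suc j
      r = rightDegree y k
      l = leftDegree y j
      noRight : ∀ {d} → k ℕ.< d → ¬ Edge y (suc d)
      noRight k<d e′ =
        edges-noncrossing e e′ z<s (ℕₚ.m<m+n (suc j) z<s) (ℕₚ.+-monoʳ-< (suc j) (s<s k<d))
      noLeft : ∀ {i d z} → z ⊕ suc i ≡ x → d ≡ suc i ℕ.+ j → ¬ Edge z (suc d)
      noLeft {i} refl refl e′ = edges-noncrossing e′ e z<s (s<s (ℕₚ.m≤m+n (suc i) j))
        (subst (ℕ._< suc i ℕ.+ (suc j ℕ.+ suc k)) (ℕₚ.+-suc (suc i) j)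
          (ℕₚ.+-monoʳ-< (suc i) (ℕₚ.m<m+n (suc j) z<s)))

    -- Here the bridges at the two outer vertices block longer edges at the apex, and the bridge at
    -- the apex accounts for 2 in place of 1.
    bridge-quiddity : Bridge x → Bridge (x ⊕ suc j) → Bridge (x ⊕ suc j ⊕ suc k) →
      quiddity Π (point (x ⊕ suc j)) ≡ 2 ℕ.+ (rightDegree (x ⊕ suc j) k ℕ.+ leftDegree (x ⊕ suc j) j)
    bridge-quiddity b₀ b₁ b₂ = ℕₚ.suc-injective (begin
      suc (quiddity Π (point y))            ≡⟨ quiddity-fan noRight noLeft ⟩
      bridgeCount y ℕ.+ suc r ℕ.+ suc l     ≡⟨ cong (λ b → b ℕ.+ suc r ℕ.+ suc l) (bridge⇒count b₁) ⟩
      suc (suc r ℕ.+ suc l)                 ≡⟨ cong suc (ℕₚ.+-suc (suc r) l) ⟩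
      suc (suc (suc (r ℕ.+ l)))             ∎)
      where
      open ≡-Reasoning
      y = x ⊕ suc j
      r = rightDegree y k
      l = leftDegree y j
      noRight : ∀ {d} → k ℕ.< d → ¬ Edge y (suc d)
      noRight k<d e′ = bridge-noncrossing e′ b₂ z<s (s<s k<d)
      noLeft : ∀ {i d z} → z ⊕ suc i ≡ x → d ≡ suc i ℕ.+ j → ¬ Edge z (suc d)
      noLeft {i} refl refl e′ = bridge-noncrossing e′ b₀ z<s (s<s (ℕₚ.m≤m+n (suc i) j))

    -- An edge at `x` with length between those of `e₁` and `e` would end strictly below `e₂` and
    -- cross it; so `e₁` is the only new edge of the fan.
    rightDegree-corner : ∀ {m} → m ≡ j ℕ.+ suc k → Edge x (suc m) →
                         rightDegree x m ≡ suc (rightDegree x j)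
    rightDegree-corner refl e =
      rightDegree-last (ℕₚ.m<m+n j z<s) (ℕₚ.<⇒≤ (edge-≤n e)) e₁
        λ j<d d<m e′ → edges-noncrossing e′ e₂ z<s (s<s j<d) (s<s d<m)

    leftDegree-corner : ∀ {m} → m ≡ j ℕ.+ suc k → Edge x (suc m) →
                        leftDegree (x ⊕ suc m) m ≡ suc (leftDegree (x ⊕ suc m) k)
    leftDegree-corner refl e =
      leftDegree-last (ℕₚ.m≤n+m (suc k) j) (ℕₚ.<⇒≤ (edge-≤n e)) e₂ (sym (⊕-assoc x (suc j) (suc k))) none
      where
      none : ∀ {d z} → k ℕ.< d → d ℕ.< j ℕ.+ suc k → z ⊕ suc d ≡ x ⊕ suc (j ℕ.+ suc k) → ¬ Edge z (suc d)
      none {d} {z} k<d d<m eq e′ with ℕₚ.m≤n⇒∃[o]m+o≡n d<m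
      ... | o , d+o≡m = edges-noncrossing e₁ (subst (λ z → Edge z (suc d)) z≡x+o e′) z<s (s<s o<j) j<o+d
        where
        o+d≡m : o ℕ.+ suc d ≡ j ℕ.+ suc k
        o+d≡m = trans (ℕₚ.+-comm o (suc d)) d+o≡m
        z≡x+o : z ≡ x ⊕ suc o
        z≡x+o = ⊕-cancelʳ (suc d) (trans eq (sym (trans (⊕-assoc x (suc o) (suc d))
                  (cong (λ t → x ⊕ suc t) o+d≡m))))
        o<j : o ℕ.< j
        o<j = ℕₚ.+-cancelʳ-< (suc d) o j (subst (ℕ._< j ℕ.+ suc d) (sym o+d≡m) (ℕₚ.+-monoʳ-< j (s<s k<d)))
        j<o+d : suc j ℕ.< suc o ℕ.+ suc d
        j<o+d = s<s (subst (j ℕ.<_) (sym o+d≡m) (ℕₚ.m<m+n j z<s))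

  -- The third vertex of the triangle below an edge is the end of the next longest edge at its start.
  triangle : ∀ {x m} → Edge x (suc (suc m)) →
    ∃[ j ] ∃[ k ] suc m ≡ j ℕ.+ suc k × Edge x (suc j) × Edge (x ⊕ suc j) (suc k)
  triangle {x} {m} e with max-below (λ d → edge? x (suc d)) m boundary
  ... | j , j≤m , e₁ , longest with ℕₚ.m≤n⇒∃[o]m+o≡n j≤m
  ...   | zero  , eq = j , 0 , trans (cong suc (sym eq)) (sym (ℕₚ.+-suc j 0)) , e₁ , boundary
  ...   | suc k , refl = j , suc k , sym (ℕₚ.+-suc j (suc k)) , e₁ ,
            uncrossed⇒edge (s<s z<s)
              (ℕₚ.≤-trans (ℕₚ.≤-trans (ℕₚ.m≤n+m (suc (suc k)) (suc j)) (ℕₚ.≤-reflexive len)) (edge-≤n e))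
              noBridge noRight noLeft
    where
    len : suc j ℕ.+ suc (suc k) ≡ suc (suc (j ℕ.+ suc k))
    len = cong suc (ℕₚ.+-suc j (suc k))

    noBridge : ∀ {i} → 0 ℕ.< i → i ℕ.< suc (suc k) → ¬ Bridge (x ⊕ suc j ⊕ i)
    noBridge {i} 0<i i<k b = bridge-noncrossing e (subst Bridge (⊕-assoc x (suc j) i) b) z<s
      (subst (suc j ℕ.+ i ℕ.<_) len (ℕₚ.+-monoʳ-< (suc j) i<k))

    noRight : ∀ {i k′} → 0 ℕ.< i → i ℕ.< suc (suc k) → suc (suc k) ℕ.< i ℕ.+ k′ → ¬ Edge (x ⊕ suc j ⊕ i) k′
    noRight {i} {k′} 0<i i<k k<i+k′ e′ =
      edges-noncrossing e (subst (λ y → Edge y k′) (⊕-assoc x (suc j) i) e′) z<s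
        (subst (suc j ℕ.+ i ℕ.<_) len (ℕₚ.+-monoʳ-< (suc j) i<k))
        (subst₂ ℕ._<_ len (sym (ℕₚ.+-assoc (suc j) i k′)) (ℕₚ.+-monoʳ-< (suc j) k<i+k′))

    noLeft : ∀ {y i k′} → y ⊕ i ≡ x ⊕ suc j → 0 ℕ.< i → i ℕ.< k′ → k′ ℕ.< i ℕ.+ suc (suc k) → ¬ Edge y k′
    -- The intruder passes over the third vertex. Starting at `x`, it contradicts the choice of `e₁`
    -- as longest; starting between `x` and the third vertex, it crosses `e₁`; starting before `x`,
    -- it crosses `e`.
    noLeft {y} {i} {k′} eq 0<i i<k′ k′<i+k e′ with ℕₚ.<-cmp i (suc j)
    noLeft {y} {i} {suc d} eq 0<i i<k′ k′<i+k e′ | tri≈ _ refl _ =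
      longest (ℕ.s<s⁻¹ i<k′) (ℕ.s≤s⁻¹ (ℕ.s≤s⁻¹ (subst (suc (suc d) ℕ.≤_) len k′<i+k)))
        (subst (λ z → Edge z (suc d)) (⊕-cancelʳ (suc j) eq) e′)
    ... | tri< i<j _ _ with ℕₚ.m≤n⇒∃[o]m+o≡n (ℕₚ.<⇒≤ i<j)
    ...   | o , i+o≡j = edges-noncrossing e₁ (subst (λ z → Edge z k′) y≡x+o e′) 0<o o<j j<o+k′
      where
      o+i≡j : o ℕ.+ i ≡ suc j
      o+i≡j = trans (ℕₚ.+-comm o i) i+o≡j
      y≡x+o : y ≡ x ⊕ o
      y≡x+o = ⊕-cancelʳ i (trans eq (sym (trans (⊕-assoc x o i) (cong (x ⊕_) o+i≡j))))
      0<o : 0 ℕ.< o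
      0<o = ℕₚ.+-cancelʳ-< i 0 o (subst (i ℕ.<_) (sym o+i≡j) i<j)
      o<j : o ℕ.< suc j
      o<j = subst (o ℕ.<_) o+i≡j (ℕₚ.m<m+n o 0<i)
      j<o+k′ : suc j ℕ.< o ℕ.+ k′
      j<o+k′ = subst (ℕ._< o ℕ.+ k′) o+i≡j (ℕₚ.+-monoʳ-< o i<k′)
    noLeft {y} {i} {k′} eq 0<i i<k′ k′<i+k e′ | tri> _ _ j<i with ℕₚ.m≤n⇒∃[o]m+o≡n (ℕₚ.<⇒≤ j<i)
    ...   | o , j+o≡i = edges-noncrossing e′ (subst (λ z → Edge z _) (sym y+o≡x) e) 0<o
              (ℕₚ.≤-<-trans (subst (o ℕ.≤_) j+o≡i (ℕₚ.m≤n+m o (suc j))) i<k′)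
              (subst (k′ ℕ.<_) total k′<i+k)
      where
      o+j≡i : o ℕ.+ suc j ≡ i
      o+j≡i = trans (ℕₚ.+-comm o (suc j)) j+o≡i
      y+o≡x : y ⊕ o ≡ x
      y+o≡x = ⊕-cancelʳ (suc j) (trans (⊕-assoc y o (suc j)) (trans (cong (y ⊕_) o+j≡i) eq))
      0<o : 0 ℕ.< o
      0<o = ℕₚ.+-cancelʳ-< (suc j) 0 o (subst (suc j ℕ.<_) (sym o+j≡i) j<i)
      total : i ℕ.+ suc (suc k) ≡ o ℕ.+ suc (suc (j ℕ.+ suc k))
      total = trans (cong (ℕ._+ suc (suc k)) (sym o+j≡i))
                (trans (ℕₚ.+-assoc o (suc j) _) (cong (o ℕ.+_) len))

  pred-length : ∀ {k} → k ℕ.≤ n → k ℕ.≤ suc (ℕ.pred n)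
  pred-length {k} k≤n = subst (k ℕ.≤_) (sym (ℕₚ.suc-pred n)) k≤n

  -- A longest edge is crossed by every edge over its start, so a bridge starts there.
  bridge-exists : ∃[ p ] Bridge (label p)
  bridge-exists with max-below {λ d → ∃[ p ] Edge (label p) (suc d)}
                       (λ d → Finₚ.any? λ p → edge? (label p) (suc d)) (ℕ.pred n)
                       (fromℕ< 0<n , boundary)
  ... | m , _ , (p , e) , longest = p , uncrossed⇒bridge noEdge
    where
    noEdge : ∀ {y j k} → y ⊕ j ≡ label p → 0 ℕ.< j → j ℕ.< k → ¬ Edge y k
    noEdge {y} {j} {suc k} y+j≡p 0<j j<k e′ with k ℕₚ.≤? m
    ... | yes k≤m = edges-noncrossing e′ (subst (λ z → Edge z (suc m)) (sym y+j≡p) e) 0<j j<k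
                      (ℕₚ.+-mono-≤ {1} 0<j (s≤s k≤m))
    ... | no  k≰m = longest (ℕₚ.≰⇒> k≰m) (ℕ.s≤s⁻¹ (pred-length (edge-≤n e′)))
                      (point y , edge-cong (sym (point-label (point y))) e′)

  -- Consecutive bridging vertices

  record NextBridge (x : ℤ) (k : ℕ) : Set where
    constructor nextBridge
    field
      bridge : Bridge (x ⊕ suc k)
      length : suc k ℕ.≤ n
      least  : ∀ {i} → i ℕ.< k → ¬ Bridge (x ⊕ suc i)

  -- The search ends by offset `n` at the latest, because `x + n` lies over the same point as `x`.
  next-bridge : ∀ {x} → Bridge x → ∃[ k ] NextBridge x k
  next-bridge {x} b with least-below {λ d → Bridge (x ⊕ suc d)} (λ d → bridge? (x ⊕ suc d)) (ℕ.pred n)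
    (bridge-cong (sym (trans (cong (point ∘ (x ⊕_)) (ℕₚ.suc-pred n)) (point-period x))) b)
  ... | k , k≤ , b′ , least = k , nextBridge b′ (subst (suc k ℕ.≤_) (ℕₚ.suc-pred n) (s≤s k≤)) least

  next-bridge-unique : ∀ {x k k′} → NextBridge x k → NextBridge x k′ → k ≡ k′
  next-bridge-unique {k = k} {k′} (nextBridge b _ least) (nextBridge b′ _ least′) with ℕₚ.<-cmp k k′
  ... | tri< k<k′ _ _ = contradiction b (least′ k<k′)
  ... | tri≈ _ eq _   = eq
  ... | tri> _ _ k′<k = contradiction b′ (least k′<k)

  next-bridge-cong : ∀ {x y k} → point x ≡ point y → NextBridge x k → NextBridge y k
  next-bridge-cong {k = k} eq (nextBridge b k≤n least) = nextBridge (bridge-cong (point-cong (+ suc k) eq) b) k≤n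
    λ {i} i<k b′ → least i<k (bridge-cong (point-cong (+ suc i) (sym eq)) b′)

  -- An edge that crosses this segment passes over one of its two ends and so crosses the bridge
  -- there; no bridge starts in between.
  next-bridge-edge : ∀ {x k} → Bridge x → NextBridge x k → Edge x (suc k)
  next-bridge-edge {k = zero} _ _ = boundary
  next-bridge-edge {x} {k@(suc _)} b (nextBridge b′ k≤n least) =
    uncrossed⇒edge (s<s z<s) k≤n noBridge noRight noLeft
    where
    noBridge : ∀ {i} → 0 ℕ.< i → i ℕ.< suc k → ¬ Bridge (x ⊕ i)
    noBridge {suc i} _ i<k = least (ℕ.s<s⁻¹ i<k)
    noRight : ∀ {i k′} → 0 ℕ.< i → i ℕ.< suc k → suc k ℕ.< i ℕ.+ k′ → ¬ Edge (x ⊕ i) k′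
    noRight {i} {k′} _ i<k k<i+k′ e′ with ℕₚ.m≤n⇒∃[o]m+o≡n (ℕₚ.<⇒≤ i<k)
    ... | o , i+o≡k = bridge-noncrossing e′
            (subst Bridge (sym (trans (⊕-assoc x i o) (cong (x ⊕_) i+o≡k))) b′)
            (ℕₚ.+-cancelˡ-< i 0 o (subst₂ ℕ._<_ (sym (ℕₚ.+-identityʳ i)) (sym i+o≡k) i<k))
            (ℕₚ.+-cancelˡ-< i o k′ (subst (ℕ._< i ℕ.+ k′) (sym i+o≡k) k<i+k′))
    noLeft : ∀ {y i k′} → y ⊕ i ≡ x → 0 ℕ.< i → i ℕ.< k′ → k′ ℕ.< i ℕ.+ suc k → ¬ Edge y k′
    noLeft refl 0<i i<k′ _ e′ = bridge-noncrossing e′ b 0<i i<k′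

-- Solutions of the quiddity recurrence

opaque
  -- Each of the `r + l` shorter edges at the middle vertex has contributed one copy of `f₁`;
  -- removing these copies leaves the coefficient `c`.
  fan-relation : ∀ f₀ f₁ f₂ {f₋ f₊} c r l → f₋ ≡ f₀ + + l * f₁ → f₊ ≡ f₂ + + r * f₁ →
                 f₋ + f₊ ≡ + (c ℕ.+ (r ℕ.+ l)) * f₁ → f₀ + f₂ ≡ + c * f₁
  fan-relation f₀ f₁ f₂ c r l refl refl eq = begin
    f₀ + f₂
      ≡⟨ lemma₁ f₀ f₁ f₂ (+ r) (+ l) ⟩
    (f₀ + + l * f₁ + (f₂ + + r * f₁)) - (+ r + + l) * f₁
      ≡⟨ cong (_- (+ r + + l) * f₁) eq ⟩
    (+ c + (+ r + + l)) * f₁ - (+ r + + l) * f₁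
      ≡⟨ lemma₂ f₁ (+ c) (+ r) (+ l) ⟩
    + c * f₁ ∎
    where
    open ≡-Reasoning
    lemma₁ : ∀ f₀ f₁ f₂ r l → f₀ + f₂ ≡ (f₀ + l * f₁ + (f₂ + r * f₁)) - (r + l) * f₁
    lemma₁ = solve-∀
    lemma₂ : ∀ f₁ c r l → (c + (r + l)) * f₁ - (r + l) * f₁ ≡ c * f₁
    lemma₂ = solve-∀

  extend-fan : ∀ f₀ f₁ f₂ {g} r → f₀ + f₂ ≡ + 1 * f₁ → g ≡ f₁ + + r * f₀ → g ≡ f₂ + + suc r * f₀
  extend-fan f₀ f₁ f₂ r eq refl =
    trans (cong (_+ + r * f₀) (trans (sym (ℤₚ.*-identityˡ f₁)) (sym eq))) (lemma f₀ f₂ (+ r))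
    where
    lemma : ∀ f₀ f₂ r → f₀ + f₂ + r * f₀ ≡ f₂ + (+ 1 + r) * f₀
    lemma = solve-∀

  extend-progression : ∀ f₀ f₁ f₂ → f₀ + f₂ ≡ + 2 * f₁ → f₂ - f₁ ≡ f₁ - f₀
  extend-progression f₀ f₁ f₂ eq =
    trans (l₁ f₀ f₁ f₂) (trans (cong (_- (f₀ + f₁)) eq) (l₂ f₀ f₁))
    where
    l₁ : ∀ f₀ f₁ f₂ → f₂ - f₁ ≡ f₀ + f₂ - (f₀ + f₁)
    l₁ = solve-∀
    l₂ : ∀ f₀ f₁ → + 2 * f₁ - (f₀ + f₁) ≡ f₁ - f₀
    l₂ = solve-∀

  progression-value : ∀ f₀ f₁ {a d} c → a ≡ f₁ + c * d → d ≡ f₁ - f₀ → a ≡ f₀ + (+ 1 + c) * (f₁ - f₀)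
  progression-value f₀ f₁ c refl refl = lemma f₀ f₁ c
    where
    lemma : ∀ f₀ f₁ c → f₁ + c * (f₁ - f₀) ≡ f₀ + (+ 1 + c) * (f₁ - f₀)
    lemma = solve-∀

  zero-right : ∀ {a b c} q → a + c ≡ q * b → a ≡ + 0 → b ≡ + 0 → c ≡ + 0
  zero-right {c = c} q eq refl refl = trans (sym (ℤₚ.+-identityˡ c)) (trans eq (ℤₚ.*-zeroʳ q))

module Solutions (n : ℕ) {{n≢0 : NonZero n}} (Π : List (Arc n)) (T : IsTriangulation Π) where
  open Cover n
  open Enumerate n
  open Edges n Π T
  open Fans n Π T

  q : ℤ → ℕ
  q x = quiddity Π (point x)

  q-cong : ∀ {x y} → point x ≡ point y → q x ≡ q y
  q-cong = cong (quiddity Π)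

  -- f t is the value at the position s + t.
  record Solution (s : ℤ) (f : ℕ → ℤ) : Set where
    constructor solves
    field
      relation : ∀ t → f t + f (2 ℕ.+ t) ≡ + q (s ⊕ suc t) * f (suc t)

  open Solution

  shift : ∀ {s f} u → Solution s f → Solution (s ⊕ u) (λ t → f (t ℕ.+ u))
  shift {s} {f} u sol .relation t = trans (relation sol (t ℕ.+ u)) (cong (λ x → + q x * f (suc t ℕ.+ u))
    (sym (trans (⊕-assoc s u (suc t)) (cong (s ⊕_) (ℕₚ.+-comm u (suc t))))))

  solution-cong : ∀ {s s′ f} → point s ≡ point s′ → Solution s f → Solution s′ f
  solution-cong {f = f} eq sol .relation t =
    trans (relation sol t) (cong (λ a → + a * f (suc t)) (q-cong (point-cong (+ suc t) eq)))

  -- At the apex, `a₂` and `b₁` turn the recurrence into `f 0 + f (suc m) = f (suc j)`. This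
  -- relation then enlarges the fans at the two corners, described by `a₁` and `b₂`, by one edge
  -- each.
  transport-step : ∀ {s f j k m} → Solution s f → m ≡ k ℕ.+ suc j → m ≡ j ℕ.+ suc k →
    Edge s (suc m) → Edge s (suc j) → Edge (s ⊕ suc j) (suc k) →
    f 1 ≡ f (suc j) + + rightDegree s j * f 0 →
    f j ≡ f 0 + + leftDegree (s ⊕ suc j) j * f (suc j) →
    f (2 ℕ.+ j) ≡ f (suc k ℕ.+ suc j) + + rightDegree (s ⊕ suc j) k * f (suc j) →
    f (k ℕ.+ suc j) ≡ f (suc j) + + leftDegree (s ⊕ suc j ⊕ suc k) k * f (suc k ℕ.+ suc j) →
    f 1 ≡ f (suc m) + + rightDegree s m * f 0 ×
    f m ≡ f 0 + + leftDegree (s ⊕ suc m) m * f (suc m)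
  transport-step {s} {f} {j} {k} sol refl eq e e₁ e₂ a₁ a₂ b₁ b₂ =
    trans (extend-fan (f 0) (f (suc j)) (f (suc m)) (rightDegree s j) apex a₁)
      (cong (λ r → f (suc m) + + r * f 0) (sym (rightDegree-corner e₁ e₂ eq e))) ,
    trans (extend-fan (f (suc m)) (f (suc j)) (f 0) (leftDegree (s ⊕ suc m) k) (trans (ℤₚ.+-comm (f (suc m)) (f 0)) apex)
            (subst (λ x → f m ≡ f (suc j) + + leftDegree x k * f (suc m)) s+j+k b₂))
      (cong (λ l → f 0 + + l * f (suc m)) (sym (leftDegree-corner e₁ e₂ eq e)))
    where
    m = k ℕ.+ suc j
    s+j+k : s ⊕ suc j ⊕ suc k ≡ s ⊕ suc m
    s+j+k = trans (⊕-assoc s (suc j) (suc k)) (cong (λ t → s ⊕ suc t) (sym eq))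
    apex : f 0 + f (suc m) ≡ + 1 * f (suc j)
    apex = fan-relation (f 0) (f (suc j)) (f (suc m)) 1 (rightDegree (s ⊕ suc j) k) (leftDegree (s ⊕ suc j) j) a₂ b₁
      (trans (relation sol j) (cong (λ a → + a * f (suc j))
        (interior-quiddity e₁ e₂ (subst (λ t → Edge s (suc t)) eq e))))

  -- The bound `N` carries the recursion: the two lower sides of the triangle are shorter than the
  -- edge, but not structurally smaller.
  transport-bounded : ∀ N {m s f} → m ℕ.< N → Solution s f → Edge s (suc m) →
    f 1 ≡ f (suc m) + + rightDegree s m * f 0 ×
    f m ≡ f 0 + + leftDegree (s ⊕ suc m) m * f (suc m)
  transport-bounded (suc N) {zero} {f = f} _ sol e = sym (ℤₚ.+-identityʳ (f 1)) , sym (ℤₚ.+-identityʳ (f 0))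
  transport-bounded (suc N) {suc m} {s} {f} m<N sol e with triangle e
  ... | j , k , eq , e₁ , e₂ =
    let a₁ , a₂ = transport-bounded N {j} {s} {f} (ℕₚ.<-≤-trans j<1+m m≤N) sol e₁
        b₁ , b₂ = transport-bounded N {k} (ℕₚ.<-≤-trans k<1+m m≤N) (shift (suc j) sol) e₂
    in transport-step sol eq′ eq e e₁ e₂ a₁ a₂ b₁ b₂
    where
    m≤N : suc m ℕ.≤ N
    m≤N = ℕ.s≤s⁻¹ m<N
    eq′ : suc m ≡ k ℕ.+ suc j
    eq′ = trans eq (trans (ℕₚ.+-suc j k) (trans (cong suc (ℕₚ.+-comm j k)) (sym (ℕₚ.+-suc k j))))
    j<1+m : j ℕ.< suc m
    j<1+m = subst (j ℕ.<_) (sym eq) (ℕₚ.m<m+n j z<s)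
    k<1+m : k ℕ.< suc m
    k<1+m = subst (k ℕ.<_) (sym eq′) (ℕₚ.m<m+n k z<s)

  -- Crossing the fan at one end of the edge, from the neighbouring vertex to the far end, removes
  -- the value at that end once per triangle.
  transport : ∀ {m s f} → Solution s f → Edge s (suc m) →
    f 1 ≡ f (suc m) + + rightDegree s m * f 0 ×
    f m ≡ f 0 + + leftDegree (s ⊕ suc m) m * f (suc m)
  transport {m} = transport-bounded (suc m) ℕₚ.≤-refl

  -- Arithmetic progressions along the bridging vertices

  bridge-progression : ∀ {s f j k} → Solution s f → Bridge s → NextBridge s j →
    NextBridge (s ⊕ suc j) k → f (suc k ℕ.+ suc j) - f (suc j) ≡ f (suc j) - f 0
  bridge-progression {s} {f} {j} {k} sol b₀ next₀@(nextBridge b₁ _ _) next₁@(nextBridge b₂ _ _) =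
    extend-progression (f 0) (f (suc j)) (f (suc k ℕ.+ suc j))
      (fan-relation (f 0) (f (suc j)) (f (suc k ℕ.+ suc j)) 2 (rightDegree (s ⊕ suc j) k) (leftDegree (s ⊕ suc j) j)
      (proj₂ (transport sol e₁))
      (proj₁ (transport {k} (shift (suc j) sol) e₂))
      (trans (relation sol j) (cong (λ a → + a * f (suc j)) (bridge-quiddity e₁ e₂ b₀ b₁ b₂))))
    where
    e₁ = next-bridge-edge b₀ next₀
    e₂ = next-bridge-edge b₁ next₁

  -- The total length is written `u + suc k` to agree definitionally with the indexing of `shift`.
  data Chain (s : ℤ) : ℕ → Set where
    stop : Chain s 0
    step : ∀ {k u} → NextBridge s k → Chain (s ⊕ suc k) u → Chain s (u ℕ.+ suc k)

  chain : ∀ N {s u} → u ℕ.≤ N → Bridge s → Bridge (s ⊕ u) → Chain s u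
  chain N       {u = zero}  _   _ _  = stop
  chain (suc N) {s} {suc u} u≤N b b′ with next-bridge b
  ... | k , next@(nextBridge b₁ _ least) with ℕₚ.m≤n⇒∃[o]m+o≡n (ℕₚ.≮⇒≥ λ u<k → least u<k b′)
  ...   | o , refl = subst (Chain s) (trans (ℕₚ.+-suc o k) (cong suc (ℕₚ.+-comm o k)))
            (step next (chain N {u = o} (ℕₚ.≤-trans (ℕₚ.m≤n+m o k) (ℕ.s≤s⁻¹ u≤N)) b₁
              (subst Bridge (sym (⊕-assoc s (suc k) o)) b′)))

  -- `c` is the number of steps of the chain. It is chosen before `f`, so that the same `c` serves a
  -- row and its translate by a period.
  chain-progression : ∀ {s u} → Chain s u → Bridge s → ∃[ c ] (∀ {f k k′} → Solution s f →
    NextBridge s k → NextBridge (s ⊕ u) k′ →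
    f u ≡ f 0 + c * (f (suc k) - f 0) × f (suc k′ ℕ.+ u) - f u ≡ f (suc k) - f 0)
  chain-progression {s} stop b = + 0 , λ {f} {k} {k′} sol next next′ →
    sym (ℤₚ.+-identityʳ (f 0)) ,
    cong (λ t → f t - f 0) (trans (ℕₚ.+-identityʳ (suc k′)) (cong suc (next-bridge-unique
      (next-bridge-cong (cong point (ℤₚ.+-identityʳ s)) next′) next)))
  chain-progression {s} (step {k₀} {u} next₀@(nextBridge b₁ _ _) ch) b
    with chain-progression ch b₁ | next-bridge b₁
  ... | c , ih | k₁ , next₁ = + 1 + c , go
    where
    go : ∀ {f k k′} → Solution s f → NextBridge s k → NextBridge (s ⊕ (u ℕ.+ suc k₀)) k′ →
         f (u ℕ.+ suc k₀) ≡ f 0 + (+ 1 + c) * (f (suc k) - f 0) ×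
         f (suc k′ ℕ.+ (u ℕ.+ suc k₀)) - f (u ℕ.+ suc k₀) ≡ f (suc k) - f 0
    go {f} {k} {k′} sol next next′ with next-bridge-unique next next₀
    ... | refl with ih {λ t → f (t ℕ.+ suc k₀)} (shift (suc k₀) sol) next₁
                     (next-bridge-cong (cong point (trans (cong (s ⊕_) (ℕₚ.+-comm u (suc k₀)))
                       (sym (⊕-assoc s (suc k₀) u)))) next′)
    ...   | value , difference =
      progression-value (f 0) (f (suc k)) c value progress ,
      trans (cong (λ t → f t - f (u ℕ.+ suc k₀)) (sym (ℕₚ.+-assoc (suc k′) u (suc k₀))))
        (trans difference progress)
      where
      progress : f (suc k₁ ℕ.+ suc k₀) - f (suc k₀) ≡ f (suc k₀) - f 0
      progress = bridge-progression sol b next₀ next₁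

  -- The second difference with step `n`

  Δ : (ℕ → ℤ) → ℕ → ℤ
  Δ f t = f (t ℕ.+ n) - f t

  Δ-solution : ∀ {s f} → Solution s f → Solution s (Δ f)
  Δ-solution {s} {f} sol .relation t = begin
    f (t ℕ.+ n) - f t + (f (2 ℕ.+ t ℕ.+ n) - f (2 ℕ.+ t))
      ≡⟨ lemma₁ (f (t ℕ.+ n)) (f t) (f (2 ℕ.+ t ℕ.+ n)) (f (2 ℕ.+ t)) ⟩
    f (t ℕ.+ n) + f (2 ℕ.+ t ℕ.+ n) - (f t + f (2 ℕ.+ t))
      ≡⟨ cong₂ _-_ (relation (solution-cong (point-period s) (shift n sol)) t) (relation sol t) ⟩
    + q (s ⊕ suc t) * f (suc t ℕ.+ n) - + q (s ⊕ suc t) * f (suc t)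
      ≡⟨ lemma₂ (+ q (s ⊕ suc t)) (f (suc t ℕ.+ n)) (f (suc t)) ⟩
    + q (s ⊕ suc t) * (f (suc t ℕ.+ n) - f (suc t)) ∎
    where
    open ≡-Reasoning
    lemma₁ : ∀ a b c d → a - b + (c - d) ≡ a + c - (b + d)
    lemma₁ = solve-∀
    lemma₂ : ∀ a x y → a * x - a * y ≡ a * (x - y)
    lemma₂ = solve-∀

  -- One period of the chain adds `c` times the first gap. The gap after that period equals the
  -- first one, so the next period adds the same amount.
  ΔΔ-bridge-0 : ∀ {s f} → Solution s f → Bridge s → Δ (Δ f) 0 ≡ + 0
  ΔΔ-bridge-0 {s} {f} sol b with next-bridge b
  ... | k , next with chain-progression (chain n ℕₚ.≤-refl b (bridge-cong (sym (point-period s)) b)) b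
  ...   | c , prog with prog {f} sol next next′
                      | prog {λ t → f (t ℕ.+ n)} (solution-cong (point-period s) (shift n sol)) next next′
    where
    next′ : NextBridge (s ⊕ n) k
    next′ = next-bridge-cong (sym (point-period s)) next
  ...     | value , difference | value′ , _ = lemma value difference value′
    where
    lemma : ∀ {f₀ fₙ f₂ₙ d d′} → fₙ ≡ f₀ + c * d → d′ ≡ d → f₂ₙ ≡ fₙ + c * d′ → f₂ₙ - fₙ - (fₙ - f₀) ≡ + 0
    lemma {f₀} {d = d} refl refl refl = ring f₀ c d
      where
      ring : ∀ f₀ c d → f₀ + c * d + c * d - (f₀ + c * d) - (f₀ + c * d - f₀) ≡ + 0
      ring = solve-∀

  ΔΔ-bridge : ∀ {s f} u → Solution s f → Bridge (s ⊕ u) → Δ (Δ f) u ≡ + 0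
  ΔΔ-bridge {s} {f} u sol b = trans
    (cong₂ (λ v w → f v - f w - (f w - f u))
      (trans (cong (ℕ._+ n) (ℕₚ.+-comm u n)) (trans (ℕₚ.+-assoc n u n)
        (trans (cong (n ℕ.+_) (ℕₚ.+-comm u n)) (sym (ℕₚ.+-assoc n n u))))) (ℕₚ.+-comm u n))
    (ΔΔ-bridge-0 (shift u sol) b)

  vanish-forward : ∀ {s g} → Solution s g → g 0 ≡ + 0 → g 1 ≡ + 0 → ∀ t → g t ≡ + 0 × g (suc t) ≡ + 0
  vanish-forward sol g₀ g₁ zero    = g₀ , g₁
  vanish-forward {s} {g} sol g₀ g₁ (suc t) =
    let gₜ , gₜ₊₁ = vanish-forward sol g₀ g₁ t
    in gₜ₊₁ , zero-right (+ q (s ⊕ suc t)) (relation sol t) gₜ gₜ₊₁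

  -- Both outer terms of the recurrence have coefficient 1, so it can be run backwards without
  -- division.
  vanish-backward : ∀ {s g} → Solution s g → ∀ u → g u ≡ + 0 → g (suc u) ≡ + 0 → g 0 ≡ + 0 × g 1 ≡ + 0
  vanish-backward sol zero    gᵤ gᵤ₊₁ = gᵤ , gᵤ₊₁
  vanish-backward {s} {g} sol (suc u) gᵤ gᵤ₊₁ = vanish-backward sol u
    (zero-right (+ q (s ⊕ suc u)) (trans (ℤₚ.+-comm (g (2 ℕ.+ u)) (g u)) (relation sol u)) gᵤ₊₁ gᵤ) gᵤ

  ΔΔ-vanishes : ∀ {s f} → Solution s f → ∀ t → Δ (Δ f) t ≡ + 0
  ΔΔ-vanishes {s} {f} sol t = proj₁ (vanish-forward sol-g (proj₁ start) (proj₂ start) t)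
    where
    g = Δ (Δ f)
    sol-g : Solution s g
    sol-g = Δ-solution (Δ-solution sol)
    start : g 0 ≡ + 0 × g 1 ≡ + 0
    -- A bridging vertex is found only somewhere to the right of `s`, at offset `suc d`. The edge to
    -- the next one gives a second zero, adjacent to it, and the pair is carried back to offset 0.
    start with bridge-exists
    ... | p , b-p with forward s p
    ...   | d , _ , s+d≡p with bridge-cong (trans (point-label p) (sym s+d≡p)) b-p
    ...     | b with next-bridge b
    ...       | k , next@(nextBridge b′ _ _) = vanish-backward sol-g u gᵤ≡0 (trans
                  (proj₁ (transport {k} (shift u sol-g) (next-bridge-edge b next)))
                  (trans (cong₂ (λ a b → a + + rightDegree (s ⊕ u) k * b) gᵤ₊ₖ≡0 gᵤ≡0)
                    (trans (ℤₚ.+-identityˡ _) (ℤₚ.*-zeroʳ (+ rightDegree (s ⊕ u) k)))))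
      where
      u = suc d
      gᵤ≡0 : g u ≡ + 0
      gᵤ≡0 = ΔΔ-bridge u sol b
      gᵤ₊ₖ≡0 : g (suc k ℕ.+ u) ≡ + 0
      gᵤ₊ₖ≡0 = ΔΔ-bridge (suc k ℕ.+ u) sol (subst Bridge
        (trans (⊕-assoc s u (suc k)) (cong (s ⊕_) (ℕₚ.+-comm u (suc k)))) b′)

  Δ-constant : ∀ {s f} → Solution s f → ∀ t l → Δ f (t ℕ.+ l ℕ.* n) ≡ Δ f t
  Δ-constant {s} {f} sol t zero    = cong (Δ f) (ℕₚ.+-identityʳ t)
  Δ-constant {s} {f} sol t (suc l) = begin
    Δ f (t ℕ.+ (n ℕ.+ l ℕ.* n))   ≡⟨ cong (Δ f) (trans (cong (t ℕ.+_) (ℕₚ.+-comm n (l ℕ.* n)))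
                                        (sym (ℕₚ.+-assoc t (l ℕ.* n) n))) ⟩
    Δ f (t ℕ.+ l ℕ.* n ℕ.+ n)     ≡⟨ ℤₚ.i-j≡0⇒i≡j _ _ (ΔΔ-vanishes sol (t ℕ.+ l ℕ.* n)) ⟩
    Δ f (t ℕ.+ l ℕ.* n)           ≡⟨ Δ-constant sol t l ⟩
    Δ f t                         ∎
    where open ≡-Reasoning

-- Rows of an infinite frieze

module Friezes {m : Array} (F : IsInfiniteFrieze m) where
  open IsInfiniteFrieze F

  -- This is the entry cancelled in `recurrence`; for `w = 0` it lies on the diagonal of ones,
  -- outside the range of `positive`.
  below-diagonal : ∀ y w → + 0 < m (y - + w) (y - + 1)
  below-diagonal y zero    =
    subst (+ 0 <_) (sym (trans (cong (λ x → m x (y - + 1)) (ℤₚ.+-identityʳ y)) (ones y))) (ℤ.+<+ z<s)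
  below-diagonal y (suc w) = positive _ _ (subst (y - + suc w ≤_) (lemma y (+ w)) (ℤₚ.i≤i+j _ (+ w)))
    where
    lemma : ∀ y w → y - (+ 1 + w) + w ≡ y - + 1
    lemma = solve-∀

  -- Subtracting two adjacent diamonds shows that the ratio
  -- (m x (y - 2) + m x y) / m x (y - 1) does not depend on x.
  recurrence : ∀ w y → m (y - + w) (y - + 2) + m (y - + w) y ≡ m y y * m (y - + w) (y - + 1)
  recurrence zero y rewrite ℤₚ.+-identityʳ y = trans (cong (_+ m y y) (zeros y))
    (trans (ℤₚ.+-identityˡ (m y y)) (trans (sym (ℤₚ.*-identityʳ (m y y))) (cong (m y y *_) (sym (ones y)))))
  recurrence (suc w) y = eliminate (m i (y - + 2)) (m i (y - + 1)) (m i y)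
    (m (y - + w) (y - + 2)) (m (y - + w) y) (m y y)
    (trans (sym (cong₂ (λ x z → m i (y - + 2) * m x z - m x (y - + 2) * m i z) i+1 (shift₂ y)))
      (diamond i (y - + 2) (subst (- + 1 ≤_) (gap₂ y (+ w)) (ℤₚ.i≤i+j (- + 1) (+ w)))))
    (trans (sym (cong₂ (λ x z → m i (y - + 1) * m x z - m x (y - + 1) * m i z) i+1 (shift₁ y)))
      (diamond i (y - + 1) (subst (- + 1 ≤_) (gap₁ y (+ w)) (ℤₚ.i≤i+j (- + 1) (+ suc w)))))
    (recurrence w y)
    where
    i : ℤ
    i = y - + suc w
    i+1≡ : ∀ y w → y - (+ 1 + w) + + 1 ≡ y - w
    i+1≡ = solve-∀
    i+1 : i + + 1 ≡ y - + w
    i+1 = i+1≡ y (+ w)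
    shift₁ : ∀ y → y - + 1 + + 1 ≡ y
    shift₁ = solve-∀
    shift₂ : ∀ y → y - + 2 + + 1 ≡ y - + 1
    shift₂ = solve-∀
    gap₁ : ∀ y w → - + 1 + (+ 1 + w) ≡ y - + 1 - (y - (+ 1 + w))
    gap₁ = solve-∀
    gap₂ : ∀ y w → - + 1 + w ≡ y - + 2 - (y - (+ 1 + w))
    gap₂ = solve-∀
    instance
      nonZero : ℤ.NonZero (m (y - + w) (y - + 1))
      nonZero = ℤ.>-nonZero (below-diagonal y w)
    eliminate : ∀ A B C A′ C′ a → let B′ = m (y - + w) (y - + 1) in
      A * B′ - A′ * B ≡ + 1 → B * C′ - B′ * C ≡ + 1 → A′ + C′ ≡ a * B′ → A + C ≡ a * B
    eliminate A B C A′ C′ a p₁ p₂ p₃ = ℤₚ.*-cancelˡ-≡ B′ (A + C) (a * B) (begin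
      B′ * (A + C)
        ≡⟨ l₁ A B C A′ B′ C′ ⟩
      A * B′ - A′ * B - (B * C′ - B′ * C) + B * (A′ + C′)
        ≡⟨ cong₂ _+_ (cong₂ _-_ p₁ p₂) (cong (B *_) p₃) ⟩
      + 0 + B * (a * B′)
        ≡⟨ l₂ B B′ a ⟩
      B′ * (a * B) ∎)
      where
      open ≡-Reasoning
      B′ = m (y - + w) (y - + 1)
      l₁ : ∀ A B C A′ B′ C′ → B′ * (A + C) ≡ A * B′ - A′ * B - (B * C′ - B′ * C) + B * (A′ + C′)
      l₁ = solve-∀
      l₂ : ∀ B B′ a → + 0 + B * (a * B′) ≡ B′ * (a * B)
      l₂ = solve-∀

module _ {n : ℕ} {h : ℤ → ℤ} (periodic : ∀ x → h x ≡ h (x + + n)) where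

  multiple-period : ∀ k x → h (x + + k * + n) ≡ h x
  multiple-period zero    x = cong h (ℤₚ.+-identityʳ x)
  multiple-period (suc k) x = trans (cong h (lemma x (+ k) (+ n)))
    (trans (sym (periodic (x + + k * + n))) (multiple-period k x))
    where
    lemma : ∀ x k n → x + (+ 1 + k) * n ≡ x + k * n + n
    lemma = solve-∀

  congruent-value : ∀ x y → + n ∣ x - y → h x ≡ h y
  congruent-value x y x~y with ∣ᵤ⇒∣ {+ n} {x - y} x~y
  ... | ℤ∣.divides (+ k) eq = trans (cong h (trans (lemma x y) (cong (λ t → y + t) eq))) (multiple-period k y)
    where
    lemma : ∀ x y → x ≡ y + (x - y)
    lemma = solve-∀
  -- `multiple-period` covers natural multiples only, so for a negative quotient `x` and `y`
  -- exchange roles.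
  ... | ℤ∣.divides -[1+ k ] eq = sym (trans
    (cong h (trans (lemma x y) (trans (cong (λ t → x - t) eq) (lemma′ x (+ suc k) (+ n)))))
    (multiple-period (suc k) x))
    where
    lemma : ∀ x y → y ≡ x - (x - y)
    lemma = solve-∀
    lemma′ : ∀ x k n → x - (- k) * n ≡ x + k * n
    lemma′ = solve-∀

proposition3p11 : (n : ℕ) → 1 ℕ.≤ n →
    (Π : List (Arc n)) → IsTriangulation Π →
    (m : Array) → IsFriezeOf Π m → IsArithmetic n m
proposition3p11 n 1≤n Π T m F l i (suc t) _ _ = begin
  m i (p + + (suc l ℕ.* n)) - m i (p + + (l ℕ.* n))
    ≡⟨ cong₂ (λ x y → m i x - m i y)
         (position (suc l ℕ.* n) (t ℕ.+ l ℕ.* n ℕ.+ n)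
           (trans (cong (t ℕ.+_) (ℕₚ.+-comm n (l ℕ.* n))) (sym (ℕₚ.+-assoc t (l ℕ.* n) n))))
         (position (l ℕ.* n) (t ℕ.+ l ℕ.* n) refl) ⟩
  Δ f (t ℕ.+ l ℕ.* n)
    ≡⟨ Δ-constant {i - + 1} {f} solution t l ⟩
  Δ f t
    ≡⟨ cong₂ (λ x y → m i x - m i y) (position n (t ℕ.+ n) refl) (base i (+ t)) ⟨
  m i (p + + n) - m i p ∎
  where
  open ≡-Reasoning
  instance
    n≢0 : NonZero n
    n≢0 = ℕ.>-nonZero 1≤n
  open Cover n
  open Solutions n Π T
  open IsFriezeOf F
  open Friezes isInfiniteFrieze

  p : ℤ
  p = i + + suc t - + 3

  -- The row starts at its zero entry in column `i - 2`, so offset `t` is column `i + k - 3` for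
  -- `k = suc t`.
  f : ℕ → ℤ
  f u = m i (i - + 2 + + u)

  base : ∀ i t → i + (+ 1 + t) - + 3 ≡ i - + 2 + t
  base = solve-∀

  position : ∀ a u → t ℕ.+ a ≡ u → p + + a ≡ i - + 2 + + u
  position a _ refl = lemma i (+ t) (+ a)
    where
    lemma : ∀ i t a → i + (+ 1 + t) - + 3 + a ≡ i - + 2 + (t + a)
    lemma = solve-∀

  diagonal : ∀ x → m x x ≡ + q x
  diagonal x = trans
    (congruent-value {n} {λ y → m y y} (λ y → isPeriodic y y ℤₚ.≤-refl) x (label (point x)) (point-over x))
    (hasQuiddity (point x))

  -- The coefficient of the entry in column `y - 1` is `m y y`, so that entry sits at position `y`
  -- of the cover. Hence the base is `i - 1`, although the row starts in column `i - 2`.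
  solution : Solution (i - + 1) f
  solution .Solution.relation u = begin
    m i (i - + 2 + + u) + m i (i - + 2 + (+ 2 + + u))
      ≡⟨ cong₂ (λ x y → m i x + m i y) (e₂ i (+ u)) (e₀ i (+ u)) ⟩
    m i (y - + 2) + m i y
      ≡⟨ subst (λ x → m x (y - + 2) + m x y ≡ m y y * m x (y - + 1)) (start i (+ u)) (recurrence u y) ⟩
    m y y * m i (y - + 1)
      ≡⟨ cong₂ _*_ (trans (diagonal y) (cong (λ x → + q x) (e₃ i (+ u)))) (cong (m i) (e₁ i (+ u))) ⟩
    + q (i - + 1 + + suc u) * m i (i - + 2 + + suc u) ∎
    where
    y : ℤ
    y = i + + u
    e₀ : ∀ i u → i - + 2 + (+ 2 + u) ≡ i + u
    e₀ = solve-∀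
    e₁ : ∀ i u → i + u - + 1 ≡ i - + 2 + (+ 1 + u)
    e₁ = solve-∀
    e₂ : ∀ i u → i - + 2 + u ≡ i + u - + 2
    e₂ = solve-∀
    e₃ : ∀ i u → i + u ≡ i - + 1 + (+ 1 + u)
    e₃ = solve-∀
    start : ∀ i u → i + u - u ≡ i
    start = solve-∀
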